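{- The set of lower accumulation points for $2$ runners is exactly $\mathcal{S}(1)=\{1/2\}$, and there are no upper accumulation points for $2$ runners.
   Context: For a real number $x$, $\Vert x\Vert$ denotes the distance from $x$ to the nearest integer. For positive integers $v_1,\ldots,v_n$, $\mathrm{ML}(v_1,\ldots,v_n)=\max_{t\in\mathbb{R}}\min_{1\le i\le n}\Vert t v_i\Vert$. Let $\mathcal{S}(n)=\{\mathrm{ML}(v_1,\ldots,v_n): v_1,\ldots,v_n \text{ positive integers}\}$. A real number $A$ is a lower accumulation point for $n$ runners if $\mathcal{S}(n)$ contains a sequence of elements strictly less than $A$ converging to $A$; it is an upper accumulation point for $n$ runners if $\mathcal{S}(n)$ contains a sequence of elements strictly greater than $A$ converging to $A$. -}

module Defs where

open import Data.Bool using (true; false)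
open import Data.Fin using (Fin; zero; suc)
open import Data.Integer as ℤ using (ℤ; +_)
import Data.Integer.DivMod as ℤ
import Data.Integer.Properties as ℤ
open import Data.Nat as ℕ using (ℕ; zero; suc)
import Data.Nat.Properties as ℕ
open import Data.Product using (Σ-syntax; ∃-syntax; _×_; _,_; proj₁; proj₂)
open import Data.Rational as ℚ using (ℚ; 0ℚ; 1ℚ; ½; floor; ceiling; round)
import Data.Rational.Properties as ℚ
open import Data.Rational.Solver using (module +-*-Solver)
import Data.Rational.Unnormalised as ℚᵘ
import Data.Rational.Unnormalised.Properties as ℚᵘ
open import Data.Sum using (inj₁; inj₂)
open import Function using (_∘_)
open import Level using (0ℓ)
open import Relation.Binary.Definitions using (tri<; tri≈; tri>)
open import Relation.Binary.PropositionalEquality using (_≡_; refl; sym; trans; cong; cong₂; subst; subst₂)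
open import Relation.Unary using (Pred)

ℤ⇒ℚ : ℤ → ℚ
ℤ⇒ℚ k = k ℚ./ 1

half+half : ∀ p → ½ ℚ.* p ℚ.+ ½ ℚ.* p ≡ p
half+half p = trans (sym (ℚ.*-distribʳ-+ p ½ ½)) (ℚ.*-identityˡ p)

half-pos : ∀ {p} → 0ℚ ℚ.< p → 0ℚ ℚ.< ½ ℚ.* p
half-pos {p} 0<p = subst (ℚ._< ½ ℚ.* p) (ℚ.*-zeroʳ ½) (ℚ.*-monoʳ-<-pos ½ 0<p)

∣p-q∣≡∣q-p∣ : ∀ p q → ℚ.∣ p ℚ.- q ∣ ≡ ℚ.∣ q ℚ.- p ∣
∣p-q∣≡∣q-p∣ p q =
  trans (sym (ℚ.∣-p∣≡∣p∣ (p ℚ.- q)))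
        (cong ℚ.∣_∣ (solve 2 (λ p q → :- (p :- q) := q :- p) refl p q))
  where open +-*-Solver

∣-∣-triangle : ∀ p q r → ℚ.∣ p ℚ.- r ∣ ℚ.≤ ℚ.∣ p ℚ.- q ∣ ℚ.+ ℚ.∣ q ℚ.- r ∣
∣-∣-triangle p q r =
  subst (λ s → ℚ.∣ s ∣ ℚ.≤ ℚ.∣ p ℚ.- q ∣ ℚ.+ ℚ.∣ q ℚ.- r ∣)
        (solve 3 (λ p q r → (p :- q) :+ (q :- r) := p :- r) refl p q r)
        (ℚ.∣p+q∣≤∣p∣+∣q∣ (p ℚ.- q) (q ℚ.- r))
  where open +-*-Solver

≤-+⇒-≤ : ∀ {p q r} → p ℚ.≤ q ℚ.+ r → p ℚ.- r ℚ.≤ q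
≤-+⇒-≤ {p} {q} {r} p≤q+r =
  subst (p ℚ.- r ℚ.≤_) (solve 2 (λ q r → q :+ r :- r := q) refl q r)
        (ℚ.+-monoˡ-≤ (ℚ.- r) p≤q+r)
  where open +-*-Solver

-≤⇒≤-+ : ∀ {p q r} → p ℚ.- r ℚ.≤ q → p ℚ.≤ q ℚ.+ r
-≤⇒≤-+ {p} {q} {r} p-r≤q =
  subst (ℚ._≤ q ℚ.+ r) (solve 2 (λ p r → p :- r :+ r := p) refl p r)
        (ℚ.+-monoˡ-≤ r p-r≤q)
  where open +-*-Solver

p≤∣p∣ : ∀ p → p ℚ.≤ ℚ.∣ p ∣
p≤∣p∣ p with ℚ.≤-total 0ℚ p
... | inj₁ 0≤p = ℚ.≤-reflexive (sym (ℚ.0≤p⇒∣p∣≡p 0≤p))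
... | inj₂ p≤0 = ℚ.≤-trans p≤0 (ℚ.0≤∣p∣ p)

∣-∣≤-intro : ∀ {p q r} → p ℚ.≤ r ℚ.+ q → q ℚ.≤ r ℚ.+ p → ℚ.∣ p ℚ.- q ∣ ℚ.≤ r
∣-∣≤-intro {p} {q} {r} p≤ q≤ with ℚ.∣p∣≡p∨∣p∣≡-p (p ℚ.- q)
... | inj₁ eq = subst (ℚ._≤ r) (sym eq) (≤-+⇒-≤ p≤)
... | inj₂ eq =
  subst (ℚ._≤ r)
        (sym (trans eq (solve 2 (λ p q → :- (p :- q) := q :- p) refl p q)))
        (≤-+⇒-≤ q≤)
  where open +-*-Solver

≤-∣-∣+ : ∀ p q → p ℚ.≤ ℚ.∣ p ℚ.- q ∣ ℚ.+ q
≤-∣-∣+ p q = -≤⇒≤-+ (p≤∣p∣ (p ℚ.- q))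

≤-∣-∣+′ : ∀ p q → q ℚ.≤ ℚ.∣ p ℚ.- q ∣ ℚ.+ p
≤-∣-∣+′ p q = subst (λ d → q ℚ.≤ d ℚ.+ p) (∣p-q∣≡∣q-p∣ q p) (≤-∣-∣+ q p)

‖_‖ℚ : ℚ → ℚ
‖ q ‖ℚ = ℚ.∣ q ℚ.- ℤ⇒ℚ (round q) ∣

toℚᵘ-ℤ⇒ℚ : ∀ k → ℚ.toℚᵘ (ℤ⇒ℚ k) ℚᵘ.≃ ℚᵘ.mkℚᵘ k 0
toℚᵘ-ℤ⇒ℚ k = ℚ.toℚᵘ-fromℚᵘ (ℚᵘ.mkℚᵘ k 0)

ℤ⇒ℚ-mono-≤ : ∀ {i j} → i ℤ.≤ j → ℤ⇒ℚ i ℚ.≤ ℤ⇒ℚ j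
ℤ⇒ℚ-mono-≤ {i} {j} i≤j = ℚ.toℚᵘ-cancel-≤
  (ℚᵘ.≤-respˡ-≃ (ℚᵘ.≃-sym (toℚᵘ-ℤ⇒ℚ i)) (ℚᵘ.≤-respʳ-≃ (ℚᵘ.≃-sym (toℚᵘ-ℤ⇒ℚ j))
    (ℚᵘ.*≤* (ℤ.*-monoʳ-≤-nonNeg (+ 1) i≤j))))

ℤ⇒ℚ-+ : ∀ i j → ℤ⇒ℚ (i ℤ.+ j) ≡ ℤ⇒ℚ i ℚ.+ ℤ⇒ℚ j
ℤ⇒ℚ-+ i j = ℚ.toℚᵘ-injective
  (ℚᵘ.≃-trans (toℚᵘ-ℤ⇒ℚ (i ℤ.+ j))
  (ℚᵘ.≃-trans (ℚᵘ.*≡* (cong (ℤ._* + 1) (sym (cong₂ ℤ._+_ (ℤ.*-identityʳ i) (ℤ.*-identityʳ j)))))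
  (ℚᵘ.≃-trans (ℚᵘ.+-cong (ℚᵘ.≃-sym (toℚᵘ-ℤ⇒ℚ i)) (ℚᵘ.≃-sym (toℚᵘ-ℤ⇒ℚ j)))
              (ℚᵘ.≃-sym (ℚ.toℚᵘ-homo-+ (ℤ⇒ℚ i) (ℤ⇒ℚ j))))))

ℤ⇒ℚ-neg : ∀ i → ℤ⇒ℚ (ℤ.- i) ≡ ℚ.- ℤ⇒ℚ i
ℤ⇒ℚ-neg i = ℚ.toℚᵘ-injective
  (ℚᵘ.≃-trans (toℚᵘ-ℤ⇒ℚ (ℤ.- i))
  (ℚᵘ.≃-trans (ℚᵘ.-‿cong (ℚᵘ.≃-sym (toℚᵘ-ℤ⇒ℚ i)))
              (ℚᵘ.≃-sym (ℚ.toℚᵘ-homo‿- (ℤ⇒ℚ i)))))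

floor-≤ : ∀ p → ℤ⇒ℚ (floor p) ℚ.≤ p
floor-≤ p@record{} = ℚ.toℚᵘ-cancel-≤
  (ℚᵘ.≤-respˡ-≃ (ℚᵘ.≃-sym (toℚᵘ-ℤ⇒ℚ (floor p)))
    (ℚᵘ.*≤* (subst (floor p ℤ.* ℚ.↧ p ℤ.≤_) (sym (ℤ.*-identityʳ (ℚ.↥ p)))
                   (ℤ.[n/d]*d≤n (ℚ.↥ p) (ℚ.↧ p)))))

≤-floor+1 : ∀ p → p ℚ.≤ ℤ⇒ℚ (floor p) ℚ.+ 1ℚ
≤-floor+1 p@record{} =
  subst (p ℚ.≤_) (trans (cong ℤ⇒ℚ (ℤ.+-comm (+ 1) (floor p))) (ℤ⇒ℚ-+ (floor p) (+ 1)))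
    (ℚ.toℚᵘ-cancel-≤ (ℚᵘ.≤-respʳ-≃ (ℚᵘ.≃-sym (toℚᵘ-ℤ⇒ℚ (ℤ.suc (floor p))))
      (ℚᵘ.*≤* (subst (ℤ._≤ ℤ.suc (floor p) ℤ.* ℚ.↧ p) (sym (ℤ.*-identityʳ (ℚ.↥ p)))
         (ℤ.<⇒≤ (subst (λ e → ℚ.↥ p ℤ.< ℤ.suc e ℤ.* ℚ.↧ p)
                       (sym (ℤ.div-pos-is-/ℕ (ℚ.↥ p) (ℚ.↧ₙ p)))
                       (ℤ.n<s[n/ℕd]*d (ℚ.↥ p) (ℚ.↧ₙ p))))))))

‖-‖ℚ-≤½ : ∀ q → ‖ q ‖ℚ ℚ.≤ ½
‖-‖ℚ-≤½ q with q ℚ.≤ᵇ 0ℚ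
... | false = ∣-∣≤-intro
  (subst₂ ℚ._≤_ (solve 2 (λ q h → q :+ h :- h := q) refl q ½)
                (solve 3 (λ f h o → f :+ o :- h := (o :- h) :+ f) refl f ½ 1ℚ)
    (ℚ.+-monoˡ-≤ (ℚ.- ½) (≤-floor+1 (q ℚ.+ ½))))
  (subst (f ℚ.≤_) (ℚ.+-comm q ½) (floor-≤ (q ℚ.+ ½)))
  where
  open +-*-Solver
  f = ℤ⇒ℚ (floor (q ℚ.+ ½))
... | true = subst (λ c → ℚ.∣ q ℚ.- c ∣ ℚ.≤ ½) (sym ceil-eq) (∣-∣≤-intro
  (subst₂ ℚ._≤_ (solve 2 (λ q f → f :+ (q :- f) := q) refl q f)
                (solve 3 (λ q h f → :- (q :- h) :+ (q :- f) := h :+ (:- f)) refl q ½ f)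
    (ℚ.+-monoˡ-≤ (q ℚ.- f) (floor-≤ (ℚ.- (q ℚ.- ½)))))
  (subst₂ ℚ._≤_ (solve 3 (λ q h f → :- (q :- h) :+ (q :- h :- f) := :- f) refl q ½ f)
                (solve 4 (λ q h f o → f :+ o :+ (q :- h :- f) := (o :- h) :+ q) refl q ½ f 1ℚ)
    (ℚ.+-monoˡ-≤ (q ℚ.- ½ ℚ.- f) (≤-floor+1 (ℚ.- (q ℚ.- ½))))))
  where
  open +-*-Solver
  f = ℤ⇒ℚ (floor (ℚ.- (q ℚ.- ½)))
  ceiling≡ : ∀ p → ceiling p ≡ ℤ.- floor (ℚ.- p)
  ceiling≡ record{} = refl
  ceil-eq : ℤ⇒ℚ (ceiling (q ℚ.- ½)) ≡ ℚ.- f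
  ceil-eq = trans (cong ℤ⇒ℚ (ceiling≡ (q ℚ.- ½))) (ℤ⇒ℚ-neg (floor (ℚ.- (q ℚ.- ½))))

½-gap : ∀ {p q r} → 1ℚ ℚ.+ p ℚ.≤ r → r ℚ.≤ ½ ℚ.+ q → ½ ℚ.≤ q ℚ.- p
½-gap {p} {q} {r} 1+p≤r r≤½+q =
  subst₂ ℚ._≤_ (solve 3 (λ o p h → o :+ p :- (h :+ p) := o :- h) refl 1ℚ p ½)
               (solve 3 (λ h q p → h :+ q :- (h :+ p) := q :- p) refl ½ q p)
    (ℚ.+-monoˡ-≤ (ℚ.- (½ ℚ.+ p)) (ℚ.≤-trans 1+p≤r r≤½+q))
  where open +-*-Solver

ℤ⇒ℚ-< : ∀ {i j} → i ℤ.< j → 1ℚ ℚ.+ ℤ⇒ℚ i ℚ.≤ ℤ⇒ℚ j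
ℤ⇒ℚ-< {i} {j} i<j =
  subst (ℚ._≤ ℤ⇒ℚ j) (ℤ⇒ℚ-+ (+ 1) i) (ℤ⇒ℚ-mono-≤ (ℤ.i<j⇒suc[i]≤j i<j))

‖-‖ℚ-nearest : ∀ q k → ‖ q ‖ℚ ℚ.≤ ℚ.∣ q ℚ.- ℤ⇒ℚ k ∣
‖-‖ℚ-nearest q k with ℤ.<-cmp k (round q)
... | tri≈ _ k≡r _ = ℚ.≤-reflexive (cong (λ j → ℚ.∣ q ℚ.- ℤ⇒ℚ j ∣) (sym k≡r))
... | tri< k<r _ _ =
  ℚ.≤-trans (‖-‖ℚ-≤½ q) (ℚ.≤-trans
    (½-gap {ℤ⇒ℚ k} {q} (ℤ⇒ℚ-< k<r)
      (ℚ.≤-trans (≤-∣-∣+′ q (ℤ⇒ℚ (round q))) (ℚ.+-monoˡ-≤ q (‖-‖ℚ-≤½ q))))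
    (p≤∣p∣ (q ℚ.- ℤ⇒ℚ k)))
... | tri> _ _ r<k =
  ℚ.≤-trans (‖-‖ℚ-≤½ q) (ℚ.≤-trans
    (½-gap {p = q} {q = k′} {r = ½ ℚ.+ (½ ℚ.+ (½ ℚ.+ r))}
      (subst (ℚ._≤ ½ ℚ.+ (½ ℚ.+ (½ ℚ.+ r))) (sym (ℚ.+-assoc ½ ½ q))
        (ℚ.+-monoʳ-≤ ½ (ℚ.+-monoʳ-≤ ½
          (ℚ.≤-trans (≤-∣-∣+ q r) (ℚ.+-monoˡ-≤ r (‖-‖ℚ-≤½ q))))))
      (ℚ.+-monoʳ-≤ ½ (subst (ℚ._≤ k′) (ℚ.+-assoc ½ ½ r) (ℤ⇒ℚ-< r<k))))
    (subst (k′ ℚ.- q ℚ.≤_) (∣p-q∣≡∣q-p∣ k′ q) (p≤∣p∣ (k′ ℚ.- q))))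
  where
  k′ = ℤ⇒ℚ k
  r  = ℤ⇒ℚ (round q)

‖-‖ℚ-lipschitz : ∀ p q → ℚ.∣ ‖ p ‖ℚ ℚ.- ‖ q ‖ℚ ∣ ℚ.≤ ℚ.∣ p ℚ.- q ∣
‖-‖ℚ-lipschitz p q = ∣-∣≤-intro
  (bound p q)
  (subst (λ d → ‖ q ‖ℚ ℚ.≤ d ℚ.+ ‖ p ‖ℚ) (∣p-q∣≡∣q-p∣ q p) (bound q p))
  where
  bound : ∀ p q → ‖ p ‖ℚ ℚ.≤ ℚ.∣ p ℚ.- q ∣ ℚ.+ ‖ q ‖ℚ
  bound p q = ℚ.≤-trans (‖-‖ℚ-nearest p (round q)) (∣-∣-triangle p q (ℤ⇒ℚ (round q)))

-- Reals are Cauchy sequences of rationals, considered up to _≃_; x < y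
-- carries a positive rational gap.
record ℝ : Set where
  constructor mkℝ
  field
    seq    : ℕ → ℚ
    cauchy : ∀ ε → 0ℚ ℚ.< ε →
             ∃[ N ] ∀ m n → N ℕ.≤ m → N ℕ.≤ n → ℚ.∣ seq m ℚ.- seq n ∣ ℚ.< ε

open ℝ public

infix 4 _≃_ _≤_ _<_

_≃_ : ℝ → ℝ → Set
x ≃ y = ∀ ε → 0ℚ ℚ.< ε → ∃[ N ] ∀ n → N ℕ.≤ n → ℚ.∣ seq x n ℚ.- seq y n ∣ ℚ.< ε

_≤_ : ℝ → ℝ → Set
x ≤ y = ∀ ε → 0ℚ ℚ.< ε → ∃[ N ] ∀ n → N ℕ.≤ n → seq x n ℚ.< seq y n ℚ.+ ε

_<_ : ℝ → ℝ → Set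
x < y = ∃[ ε ] 0ℚ ℚ.< ε × ∃[ N ] ∀ n → N ℕ.≤ n → seq x n ℚ.+ ε ℚ.< seq y n

fromℚ : ℚ → ℝ
fromℚ q .seq    _     = q
fromℚ q .cauchy ε 0<ε = 0 , λ _ _ _ _ →
  subst (λ d → ℚ.∣ d ∣ ℚ.< ε) (sym (ℚ.+-inverseʳ q)) 0<ε

lift₁ : (f : ℚ → ℚ) (L : ℚ) .{{_ : ℚ.Positive L}} →
        (∀ p q → ℚ.∣ f p ℚ.- f q ∣ ℚ.≤ L ℚ.* ℚ.∣ p ℚ.- q ∣) → ℝ → ℝ
lift₁ f L lip x .seq n = f (seq x n)
lift₁ f L {{L>0}} lip x .cauchy ε 0<ε = N , λ m n N≤m N≤n →
    ℚ.≤-<-trans (lip (seq x m) (seq x n))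
      (subst (L ℚ.* ℚ.∣ seq x m ℚ.- seq x n ∣ ℚ.<_) L*δ≡ε
             (ℚ.*-monoʳ-<-pos L (bound m n N≤m N≤n)))
  where
  instance
    L≢0 : ℚ.NonZero L
    L≢0 = ℚ.pos⇒nonZero L
    1/L>0 : ℚ.Positive (ℚ.1/ L)
    1/L>0 = ℚ.1/pos⇒pos L
  δ = ℚ.1/ L ℚ.* ε
  0<δ : 0ℚ ℚ.< δ
  0<δ = subst (ℚ._< δ) (ℚ.*-zeroʳ (ℚ.1/ L)) (ℚ.*-monoʳ-<-pos (ℚ.1/ L) 0<ε)
  L*δ≡ε : L ℚ.* δ ≡ ε
  L*δ≡ε = trans (sym (ℚ.*-assoc L (ℚ.1/ L) ε))
                (trans (cong (ℚ._* ε) (ℚ.*-inverseʳ L)) (ℚ.*-identityˡ ε))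
  N     = proj₁ (cauchy x δ 0<δ)
  bound = proj₂ (cauchy x δ 0<δ)

lift₂ : (f : ℚ → ℚ → ℚ) →
        (∀ p q r s → ℚ.∣ f p q ℚ.- f r s ∣ ℚ.≤ ℚ.∣ p ℚ.- r ∣ ℚ.+ ℚ.∣ q ℚ.- s ∣) →
        ℝ → ℝ → ℝ
lift₂ f lip x y .seq n = f (seq x n) (seq y n)
lift₂ f lip x y .cauchy ε 0<ε = Nx ℕ.⊔ Ny , λ m n N≤m N≤n →
    ℚ.≤-<-trans (lip (seq x m) (seq y m) (seq x n) (seq y n))
      (subst (ℚ.∣ seq x m ℚ.- seq x n ∣ ℚ.+ ℚ.∣ seq y m ℚ.- seq y n ∣ ℚ.<_) (half+half ε)
        (ℚ.+-mono-<
          (bx m n (ℕ.≤-trans (ℕ.m≤m⊔n Nx Ny) N≤m) (ℕ.≤-trans (ℕ.m≤m⊔n Nx Ny) N≤n))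
          (by m n (ℕ.≤-trans (ℕ.m≤n⊔m Nx Ny) N≤m) (ℕ.≤-trans (ℕ.m≤n⊔m Nx Ny) N≤n))))
  where
  cx = cauchy x (½ ℚ.* ε) (half-pos 0<ε)
  cy = cauchy y (½ ℚ.* ε) (half-pos 0<ε)
  Nx = proj₁ cx
  Ny = proj₁ cy
  bx = proj₂ cx
  by = proj₂ cy

1-lipschitz : ∀ {f : ℚ → ℚ} → (∀ p q → ℚ.∣ f p ℚ.- f q ∣ ℚ.≤ ℚ.∣ p ℚ.- q ∣) →
              ∀ p q → ℚ.∣ f p ℚ.- f q ∣ ℚ.≤ 1ℚ ℚ.* ℚ.∣ p ℚ.- q ∣
1-lipschitz {f} lip p q =
  subst (ℚ.∣ f p ℚ.- f q ∣ ℚ.≤_) (sym (ℚ.*-identityˡ ℚ.∣ p ℚ.- q ∣)) (lip p q)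

∣-∣-lipschitz : ∀ p q → ℚ.∣ ℚ.∣ p ∣ ℚ.- ℚ.∣ q ∣ ∣ ℚ.≤ ℚ.∣ p ℚ.- q ∣
∣-∣-lipschitz p q = ∣-∣≤-intro
  (bound p q)
  (subst (λ d → ℚ.∣ q ∣ ℚ.≤ d ℚ.+ ℚ.∣ p ∣) (∣p-q∣≡∣q-p∣ q p) (bound q p))
  where
  open +-*-Solver
  bound : ∀ p q → ℚ.∣ p ∣ ℚ.≤ ℚ.∣ p ℚ.- q ∣ ℚ.+ ℚ.∣ q ∣
  bound p q = subst (λ s → ℚ.∣ s ∣ ℚ.≤ ℚ.∣ p ℚ.- q ∣ ℚ.+ ℚ.∣ q ∣)
                    (solve 2 (λ p q → (p :- q) :+ q := p) refl p q)
                    (ℚ.∣p+q∣≤∣p∣+∣q∣ (p ℚ.- q) q)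

minus-lipschitz : ∀ p q r s →
  ℚ.∣ (p ℚ.- q) ℚ.- (r ℚ.- s) ∣ ℚ.≤ ℚ.∣ p ℚ.- r ∣ ℚ.+ ℚ.∣ q ℚ.- s ∣
minus-lipschitz p q r s =
  subst (λ d → ℚ.∣ d ∣ ℚ.≤ ℚ.∣ p ℚ.- r ∣ ℚ.+ ℚ.∣ q ℚ.- s ∣)
        (solve 4 (λ p q r s → (p :- r) :- (q :- s) := (p :- q) :- (r :- s)) refl p q r s)
        (ℚ.∣p-q∣≤∣p∣+∣q∣ (p ℚ.- r) (q ℚ.- s))
  where open +-*-Solver

⊓-lipschitz : ∀ p q r s →
  ℚ.∣ (p ℚ.⊓ q) ℚ.- (r ℚ.⊓ s) ∣ ℚ.≤ ℚ.∣ p ℚ.- r ∣ ℚ.+ ℚ.∣ q ℚ.- s ∣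
⊓-lipschitz p q r s = ∣-∣≤-intro
  (bound p q r s)
  (subst (λ d → r ℚ.⊓ s ℚ.≤ d ℚ.+ p ℚ.⊓ q)
         (cong₂ ℚ._+_ (∣p-q∣≡∣q-p∣ r p) (∣p-q∣≡∣q-p∣ s q)) (bound r s p q))
  where
  weakenˡ : ∀ a b c → 0ℚ ℚ.≤ b → a ℚ.+ c ℚ.≤ (a ℚ.+ b) ℚ.+ c
  weakenˡ a b c 0≤b = ℚ.+-monoˡ-≤ c
    (subst (ℚ._≤ a ℚ.+ b) (ℚ.+-identityʳ a) (ℚ.+-monoʳ-≤ a 0≤b))
  weakenʳ : ∀ a b c → 0ℚ ℚ.≤ a → b ℚ.+ c ℚ.≤ (a ℚ.+ b) ℚ.+ c
  weakenʳ a b c 0≤a = ℚ.+-monoˡ-≤ c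
    (subst (ℚ._≤ a ℚ.+ b) (ℚ.+-identityˡ b) (ℚ.+-monoˡ-≤ b 0≤a))
  bound : ∀ p q r s → p ℚ.⊓ q ℚ.≤ (ℚ.∣ p ℚ.- r ∣ ℚ.+ ℚ.∣ q ℚ.- s ∣) ℚ.+ r ℚ.⊓ s
  bound p q r s with ℚ.⊓-sel r s
  ... | inj₁ eq rewrite eq = ℚ.≤-trans (ℚ.p⊓q≤p p q) (ℚ.≤-trans (≤-∣-∣+ p r)
    (weakenˡ ℚ.∣ p ℚ.- r ∣ ℚ.∣ q ℚ.- s ∣ r (ℚ.0≤∣p∣ (q ℚ.- s))))
  ... | inj₂ eq rewrite eq = ℚ.≤-trans (ℚ.p⊓q≤q p q) (ℚ.≤-trans (≤-∣-∣+ q s)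
    (weakenʳ ℚ.∣ p ℚ.- r ∣ ℚ.∣ q ℚ.- s ∣ s (ℚ.0≤∣p∣ (p ℚ.- r))))

·-lipschitz : ∀ v p q →
  ℚ.∣ p ℚ.* ℤ⇒ℚ (+ v) ℚ.- q ℚ.* ℤ⇒ℚ (+ v) ∣ ℚ.≤ ℤ⇒ℚ (+ suc v) ℚ.* ℚ.∣ p ℚ.- q ∣
·-lipschitz v p q =
  subst (ℚ._≤ ℤ⇒ℚ (+ suc v) ℚ.* ℚ.∣ p ℚ.- q ∣) eq
    (ℚ.*-monoʳ-≤-nonNeg ℚ.∣ p ℚ.- q ∣ {{ℚ.∣-∣-nonNeg (p ℚ.- q)}}
      (ℤ⇒ℚ-mono-≤ {+ v} {+ suc v} (ℤ.+≤+ (ℕ.n≤1+n v))))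
  where
  open +-*-Solver
  w = ℤ⇒ℚ (+ v)
  0≤w : 0ℚ ℚ.≤ w
  0≤w = ℤ⇒ℚ-mono-≤ {+ 0} {+ v} (ℤ.+≤+ ℕ.z≤n)
  eq : w ℚ.* ℚ.∣ p ℚ.- q ∣ ≡ ℚ.∣ p ℚ.* w ℚ.- q ℚ.* w ∣
  eq = trans (cong (ℚ._* ℚ.∣ p ℚ.- q ∣) (sym (ℚ.0≤p⇒∣p∣≡p 0≤w)))
       (trans (sym (ℚ.∣p*q∣≡∣p∣*∣q∣ w (p ℚ.- q)))
              (cong ℚ.∣_∣ (solve 3 (λ p q w → w :* (p :- q) := p :* w :- q :* w) refl p q w)))

infixl 7 _·_ _⊓_
infixl 6 _-_

_-_ : ℝ → ℝ → ℝ
_-_ = lift₂ ℚ._-_ minus-lipschitz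

_⊓_ : ℝ → ℝ → ℝ
_⊓_ = lift₂ ℚ._⊓_ ⊓-lipschitz

∣_∣ : ℝ → ℝ
∣_∣ = lift₁ ℚ.∣_∣ 1ℚ (1-lipschitz {ℚ.∣_∣} ∣-∣-lipschitz)

_·_ : ℝ → ℕ → ℝ
t · v = lift₁ (ℚ._* ℤ⇒ℚ (+ v)) (ℤ⇒ℚ (+ suc v)) {{ℚ.normalize-pos (suc v) 1}} (·-lipschitz v) t

-- Distance to the nearest integer, applied termwise. A nearest integer
-- of a real cannot be chosen constructively; ‖-‖-lower and
-- ‖-‖-approached state that ‖ x ‖ is the infimum of ∣ x - k ∣ over
-- the integers k.
‖_‖ : ℝ → ℝ
‖_‖ = lift₁ ‖_‖ℚ 1ℚ (1-lipschitz {‖_‖ℚ} ‖-‖ℚ-lipschitz)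

‖-‖-lower : ∀ x k → ‖ x ‖ ≤ ∣ x - fromℚ (ℤ⇒ℚ k) ∣
‖-‖-lower x k ε 0<ε = 0 , λ n _ → ℚ.≤-<-trans (‖-‖ℚ-nearest (seq x n) k)
  (subst (ℚ._< ℚ.∣ seq x n ℚ.- ℤ⇒ℚ k ∣ ℚ.+ ε) (ℚ.+-identityʳ _)
         (ℚ.+-monoʳ-< ℚ.∣ seq x n ℚ.- ℤ⇒ℚ k ∣ 0<ε))

‖-‖-approached : ∀ x ε → 0ℚ ℚ.< ε → ∃[ k ] ∣ x - fromℚ (ℤ⇒ℚ k) ∣ - ‖ x ‖ ≤ fromℚ ε
‖-‖-approached x ε 0<ε = round (seq x N) , λ η 0<η → N , λ n N≤n →
  let d  = ℚ.∣ seq x n ℚ.- seq x N ∣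
      d< = bound n N N≤n ℕ.≤-refl
      y  = ‖ seq x n ‖ℚ
      k  = ℤ⇒ℚ (round (seq x N))
  in ℚ.≤-<-trans
       (≤-+⇒-≤ {r = y}
         (ℚ.≤-trans (∣-∣-triangle (seq x n) (seq x N) k)
         (ℚ.≤-trans (ℚ.+-monoʳ-≤ d (ℚ.≤-trans (≤-∣-∣+′ y ‖ seq x N ‖ℚ)
                       (ℚ.+-monoˡ-≤ y (‖-‖ℚ-lipschitz (seq x n) (seq x N)))))
                    (ℚ.≤-reflexive (sym (ℚ.+-assoc d d y))))))
       (ℚ.<-trans (subst (d ℚ.+ d ℚ.<_) (half+half ε) (ℚ.+-mono-< d< d<))
                  (subst (ℚ._< ε ℚ.+ η) (ℚ.+-identityʳ ε) (ℚ.+-monoʳ-< ε 0<η)))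
  where
  c     = cauchy x (½ ℚ.* ε) (half-pos 0<ε)
  N     = proj₁ c
  bound = proj₂ c

min : ∀ n .{{_ : ℕ.NonZero n}} → (Fin n → ℝ) → ℝ
min (suc zero)    f = f zero
min (suc (suc n)) f = f zero ⊓ min (suc n) (f ∘ suc)

IsMax : (ℝ → ℝ) → ℝ → Set
IsMax f M = (∃[ t ] f t ≃ M) × (∀ t → f t ≤ M)

-- IsML n v M says ML(v₁, …, vₙ) = M, with the maximum over t attained.
IsML : ∀ n .{{_ : ℕ.NonZero n}} → (Fin n → ℕ) → ℝ → Set
IsML n v = IsMax λ t → min n λ i → ‖ t · v i ‖

𝓢 : ∀ n .{{_ : ℕ.NonZero n}} → Pred ℝ 0ℓ
𝓢 n M = Σ[ v ∈ (Fin n → ℕ) ] (∀ i → 0 ℕ.< v i) × IsML n v M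

_ConvergesTo_ : (ℕ → ℝ) → ℝ → Set
x ConvergesTo A = ∀ ε → 0ℚ ℚ.< ε → ∃[ N ] ∀ n → N ℕ.≤ n → ∣ x n - A ∣ < fromℚ ε

LowerAccumulationPoint : ∀ n .{{_ : ℕ.NonZero n}} → Pred ℝ 0ℓ
LowerAccumulationPoint n A =
  Σ[ x ∈ (ℕ → ℝ) ] (∀ k → 𝓢 n (x k)) × (∀ k → x k < A) × x ConvergesTo A

UpperAccumulationPoint : ∀ n .{{_ : ℕ.NonZero n}} → Pred ℝ 0ℓ
UpperAccumulationPoint n A =
  Σ[ x ∈ (ℕ → ℝ) ] (∀ k → 𝓢 n (x k)) × (∀ k → A < x k) × x ConvergesTo A

{-# OPTIONS --safe #-}
module Submission where

open import Defs
open import Data.Fin using (Fin; zero; suc)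
open import Data.Integer as ℤ using (ℤ; +_)
import Data.Integer.Properties as ℤ
import Data.Integer.Solver as ℤSolver
open import Data.Nat as ℕ using (ℕ; zero; suc)
open import Data.Nat.Coprimality using (Coprime; coprime-+; coprime-/gcd; coprime-Bézout)
import Data.Nat.Coprimality as Coprimality
open import Data.Nat.Divisibility using (divides)
import Data.Nat.DivMod as ℕ
open import Data.Nat.GCD using (gcd; gcd[m,n]∣m; gcd[m,n]∣n; gcd[m,n]≢0; module Bézout)
open import Data.Nat.Induction using (<-wellFounded)
import Data.Nat.Properties as ℕ
import Data.Nat.Solver as ℕSolver
open import Data.Product using (∃-syntax; _×_; _,_; proj₁; proj₂)
open import Data.Rational as ℚ using (ℚ; 0ℚ; 1ℚ; ½; floor; round)
import Data.Rational.Properties as ℚ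
open import Data.Rational.Solver using (module +-*-Solver)
import Data.Rational.Unnormalised as ℚᵘ
import Data.Rational.Unnormalised.Properties as ℚᵘ
open import Data.Sum using (_⊎_; inj₁; inj₂; [_,_]′)
open import Induction.WellFounded using (Acc; acc)
open import Relation.Binary.PropositionalEquality using (_≡_; refl; sym; trans; cong; cong₂; subst; subst₂; module ≡-Reasoning)
open import Relation.Nullary using (¬_; contradiction; yes; no)
open import Relation.Unary using (_≐_)

-- Let v₁ = da and v₂ = db with a, b coprime. If both are odd, t = 1/(2d) gives
-- ML = 1/2. Otherwise s = a + b = 2h + 1 is odd and ML = h/s: choosing r with
-- ra ≡ h (mod s), so that rb ≡ h + 1, the time t = r/(ds) attains h/s; and if
-- ‖pa‖ and ‖pb‖ both exceeded h/s, comparing b(pa) = a(pb) with the floors of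
-- pa and pb would trap an integer strictly between two consecutive integers.
-- The values h/(2h + 1) increase strictly to 1/2, so a strictly increasing
-- sequence of values can only tend to 1/2, and a strictly decreasing one would
-- give an infinite descent in h.

-- Rearranging inequalities between rationals

shift-≤ : ∀ {p q r s} → p ℚ.≤ q → q ℚ.- p ≡ s ℚ.- r → r ℚ.≤ s
shift-≤ {p} {q} {r} {s} p≤q eq = subst₂ ℚ._≤_
  (solve 2 (λ p r → p :+ (r :- p) := r) refl p r)
  (trans (solve 3 (λ p q r → q :+ (r :- p) := (q :- p) :+ r) refl p q r)
  (trans (cong (ℚ._+ r) eq) (solve 2 (λ r s → (s :- r) :+ r := s) refl r s)))
  -- Adding `r - p` to both sides. With this, rearranging a linear inequality reduces to an identity
  -- between differences, which the ring solver can check.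
  (ℚ.+-monoˡ-≤ (r ℚ.- p) p≤q)
  where open +-*-Solver

shift-< : ∀ {p q r s} → p ℚ.< q → q ℚ.- p ≡ s ℚ.- r → r ℚ.< s
shift-< {p} {q} {r} {s} p<q eq = subst₂ ℚ._<_
  (solve 2 (λ p r → p :+ (r :- p) := r) refl p r)
  (trans (solve 3 (λ p q r → q :+ (r :- p) := (q :- p) :+ r) refl p q r)
  (trans (cong (ℚ._+ r) eq) (solve 2 (λ r s → (s :- r) :+ r := s) refl r s)))
  (ℚ.+-monoˡ-< (r ℚ.- p) p<q)
  where open +-*-Solver

p<p+ε : ∀ p {ε} → 0ℚ ℚ.< ε → p ℚ.< p ℚ.+ ε
p<p+ε p {ε} 0<ε = subst (ℚ._< p ℚ.+ ε) (ℚ.+-identityʳ p) (ℚ.+-monoʳ-< p 0<ε)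

∣p-q∣<ε⇒p<q+ε : ∀ p q {ε} → ℚ.∣ p ℚ.- q ∣ ℚ.< ε → p ℚ.< q ℚ.+ ε
∣p-q∣<ε⇒p<q+ε p q {ε} d<ε = ℚ.≤-<-trans (≤-∣-∣+ p q)
  (subst (_ ℚ.<_) (ℚ.+-comm ε q) (ℚ.+-monoˡ-< q d<ε))

∣p-q∣<ε⇒q<p+ε : ∀ p q {ε} → ℚ.∣ p ℚ.- q ∣ ℚ.< ε → q ℚ.< p ℚ.+ ε
∣p-q∣<ε⇒q<p+ε p q d<ε = ∣p-q∣<ε⇒p<q+ε q p (subst (ℚ._< _) (∣p-q∣≡∣q-p∣ p q) d<ε)

∣-∣<-intro : ∀ {p q ε} → p ℚ.< q ℚ.+ ε → q ℚ.< p ℚ.+ ε → ℚ.∣ p ℚ.- q ∣ ℚ.< ε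
∣-∣<-intro {p} {q} {ε} p< q< with ℚ.∣p∣≡p∨∣p∣≡-p (p ℚ.- q)
... | inj₁ eq = subst (ℚ._< ε) (sym eq)
  (shift-< p< (solve 3 (λ p q e → (q :+ e) :- p := e :- (p :- q)) refl p q ε))
  where open +-*-Solver
... | inj₂ eq = subst (ℚ._< ε) (sym eq)
  (shift-< q< (solve 3 (λ p q e → (p :+ e) :- q := e :- (:- (p :- q))) refl p q ε))
  where open +-*-Solver

-- The embeddings of naturals and integers into the rationals

fromℕ : ℕ → ℚ
fromℕ n = ℤ⇒ℚ (+ n)

fromℕ-pos : ∀ n .{{_ : ℕ.NonZero n}} → ℚ.Positive (fromℕ n)
fromℕ-pos n = ℚ.normalize-pos n 1

fromℕ-nonNeg : ∀ n → ℚ.NonNegative (fromℕ n)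
fromℕ-nonNeg n = ℚ.normalize-nonNeg n 1

ℤ⇒ℚ-* : ∀ i j → ℤ⇒ℚ (i ℤ.* j) ≡ ℤ⇒ℚ i ℚ.* ℤ⇒ℚ j
ℤ⇒ℚ-* i j = ℚ.toℚᵘ-injective
  (ℚᵘ.≃-trans (toℚᵘ-ℤ⇒ℚ (i ℤ.* j))
  (ℚᵘ.≃-trans (ℚᵘ.*-cong (ℚᵘ.≃-sym (toℚᵘ-ℤ⇒ℚ i)) (ℚᵘ.≃-sym (toℚᵘ-ℤ⇒ℚ j)))
              (ℚᵘ.≃-sym (ℚ.toℚᵘ-homo-* (ℤ⇒ℚ i) (ℤ⇒ℚ j)))))

ℤ⇒ℚ-cancel-< : ∀ {i j} → ℤ⇒ℚ i ℚ.< ℤ⇒ℚ j → i ℤ.< j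
ℤ⇒ℚ-cancel-< ιi<ιj = ℤ.≰⇒> λ j≤i → ℚ.<-irrefl refl (ℚ.<-≤-trans ιi<ιj (ℤ⇒ℚ-mono-≤ j≤i))

fromℕ-* : ∀ m n → fromℕ (m ℕ.* n) ≡ fromℕ m ℚ.* fromℕ n
fromℕ-* m n = trans (cong ℤ⇒ℚ (ℤ.pos-* m n)) (ℤ⇒ℚ-* (+ m) (+ n))

fromℕ-mono-≤ : ∀ {m n} → m ℕ.≤ n → fromℕ m ℚ.≤ fromℕ n
fromℕ-mono-≤ m≤n = ℤ⇒ℚ-mono-≤ (ℤ.+≤+ m≤n)

-- Clears denominators: `_/_` reduces to lowest terms, so the product does not compute, and the
-- equation is checked on unnormalised fractions.
i/n*n≡i : ∀ i n .{{_ : ℕ.NonZero n}} → (i ℚ./ n) ℚ.* fromℕ n ≡ ℤ⇒ℚ i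
i/n*n≡i i n@(suc m) = ℚ.toℚᵘ-injective
  (ℚᵘ.≃-trans (ℚ.toℚᵘ-homo-* (i ℚ./ n) (fromℕ n))
  (ℚᵘ.≃-trans (ℚᵘ.*-cong (ℚ.toℚᵘ-fromℚᵘ (ℚᵘ.mkℚᵘ i m)) (toℚᵘ-ℤ⇒ℚ (+ n)))
  (ℚᵘ.≃-trans (ℚᵘ.*≡* (ℤ.*-assoc i (+ n) (+ 1)))
              (ℚᵘ.≃-sym (toℚᵘ-ℤ⇒ℚ i)))))

*-cancelʳ-pos : ∀ r .{{_ : ℚ.Positive r}} {p q} → p ℚ.* r ≡ q ℚ.* r → p ≡ q
*-cancelʳ-pos r eq = ℚ.≤-antisym
  (ℚ.*-cancelʳ-≤-pos r (ℚ.≤-reflexive eq))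
  (ℚ.*-cancelʳ-≤-pos r (ℚ.≤-reflexive (sym eq)))

-- The values h/(2h + 1): monotonicity and convergence to 1/2

2h+1 : ∀ h → fromℕ (suc (2 ℕ.* h)) ≡ 1ℚ ℚ.+ (1ℚ ℚ.+ 1ℚ) ℚ.* fromℕ h
2h+1 h = trans (ℤ⇒ℚ-+ (+ 1) (+ (2 ℕ.* h))) (cong (1ℚ ℚ.+_) (fromℕ-* 2 h))

-- val h = ½ - 1/(2s) with s = 2h + 1; it is ML(a, b) for coprime a, b with a + b = s.
val : ℕ → ℚ
val h = + h ℚ./ suc (2 ℕ.* h)

val-* : ∀ h → val h ℚ.* fromℕ (suc (2 ℕ.* h)) ≡ fromℕ h
val-* h = i/n*n≡i (+ h) (suc (2 ℕ.* h))

-- Cross-multiplied, `h (2k + 1) ≤ k (2h + 1)` is `h ≤ k` with `2hk` added on both sides.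
val-mono-≤ : ∀ {h k} → h ℕ.≤ k → val h ℚ.≤ val k
val-mono-≤ {h} {k} h≤k = ℚ.toℚᵘ-cancel-≤
  (ℚᵘ.≤-respˡ-≃ (ℚᵘ.≃-sym (ℚ.toℚᵘ-fromℚᵘ (ℚᵘ.mkℚᵘ (+ h) (2 ℕ.* h))))
  (ℚᵘ.≤-respʳ-≃ (ℚᵘ.≃-sym (ℚ.toℚᵘ-fromℚᵘ (ℚᵘ.mkℚᵘ (+ k) (2 ℕ.* k))))
  (ℚᵘ.*≤* (subst₂ ℤ._≤_ (ℤ.pos-* h (suc (2 ℕ.* k))) (ℤ.pos-* k (suc (2 ℕ.* h))) (ℤ.+≤+
    (subst₂ ℕ._≤_
      (solve 2 (λ h k → h :+ con 2 :* h :* k := h :* (con 1 :+ con 2 :* k)) refl h k)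
      (solve 2 (λ h k → k :+ con 2 :* h :* k := k :* (con 1 :+ con 2 :* h)) refl h k)
      (ℕ.+-monoˡ-≤ (2 ℕ.* h ℕ.* k) h≤k)))))))
  where open ℕSolver.+-*-Solver

val-cancel-< : ∀ {h k} → val h ℚ.< val k → h ℕ.< k
val-cancel-< lt = ℕ.≰⇒> λ k≤h → ℚ.<-irrefl refl (ℚ.<-≤-trans lt (val-mono-≤ k≤h))

½*[2h+1] : ∀ h → ½ ℚ.* fromℕ (suc (2 ℕ.* h)) ≡ ½ ℚ.+ fromℕ h
½*[2h+1] h = trans (cong (½ ℚ.*_) (2h+1 h))
  (trans (solve 3 (λ o k x → k :* (o :+ (o :+ o) :* x) := k :* o :+ (k :* (o :+ o)) :* x)
                refl 1ℚ ½ (fromℕ h))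
         -- The closed products `½ * 1ℚ` and `½ * (1ℚ + 1ℚ)` evaluate to `½` and `1ℚ` by
         -- computation.
         (cong (½ ℚ.+_) (ℚ.*-identityˡ (fromℕ h))))
  where open +-*-Solver

val<½ : ∀ h → val h ℚ.< ½
val<½ h = ℚ.*-cancelʳ-<-nonNeg n {{fromℕ-nonNeg (suc (2 ℕ.* h))}}
  (subst₂ ℚ._<_ (sym (val-* h)) (sym (trans (½*[2h+1] h) (ℚ.+-comm ½ (fromℕ h))))
          (p<p+ε (fromℕ h) (ℚ.positive⁻¹ ½)))
  where n = fromℕ (suc (2 ℕ.* h))

1≤↥ : ∀ {ε} → 0ℚ ℚ.< ε → 1ℚ ℚ.≤ ℤ⇒ℚ (ℚ.↥ ε)
1≤↥ {ε} 0<ε with ε | ℚ.positive 0<ε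
... | ℚ.mkℚ ℤ.+[1+ n ] _ _ | _ = fromℕ-mono-≤ {1} {suc n} (ℕ.s≤s ℕ.z≤n)

-- Multiplied by `s = 2h + 1`, the claim becomes `½ < ε s`. The threshold is the denominator of `ε`:
-- past it, `ε s` is at least the numerator of `ε`, hence at least 1.
½<val+ε : ∀ {ε} → 0ℚ ℚ.< ε → ∃[ N ] ∀ h → N ℕ.≤ h → ½ ℚ.< val h ℚ.+ ε
½<val+ε {ε} 0<ε = ℚ.↧ₙ ε , λ h N≤h →
  let n = fromℕ (suc (2 ℕ.* h)) in
  ℚ.*-cancelʳ-<-nonNeg n {{fromℕ-nonNeg (suc (2 ℕ.* h))}}
  (subst₂ ℚ._<_ (trans (ℚ.+-comm (fromℕ h) ½) (sym (½*[2h+1] h)))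
    (trans (cong (ℚ._+ ε ℚ.* n) (sym (val-* h))) (sym (ℚ.*-distribʳ-+ n (val h) ε)))
    (ℚ.+-monoʳ-< (fromℕ h) (begin-strict
      ½                      <⟨ ½<1 ⟩
      1ℚ                     ≤⟨ 1≤↥ 0<ε ⟩
      ℤ⇒ℚ (ℚ.↥ ε)            ≡⟨ i/n*n≡i (ℚ.↥ ε) (ℚ.↧ₙ ε) ⟨
      (ℚ.↥ ε ℚ./ ℚ.↧ₙ ε) ℚ.* fromℕ (ℚ.↧ₙ ε) ≡⟨ cong (ℚ._* fromℕ (ℚ.↧ₙ ε)) (ℚ.↥p/↧p≡p ε) ⟩
      ε ℚ.* fromℕ (ℚ.↧ₙ ε)   ≤⟨ ℚ.*-monoˡ-≤-nonNeg ε {{ℚ.nonNegative (ℚ.<⇒≤ 0<ε)}}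
                                  (fromℕ-mono-≤ (ℕ.≤-trans N≤h (ℕ.m≤n⇒m≤1+n (ℕ.m≤m+n h _)))) ⟩
      ε ℚ.* n                ∎)))
  where
  open ℚ.≤-Reasoning
  ½<1 : ½ ℚ.< 1ℚ
  ½<1 = p<p+ε ½ (ℚ.positive⁻¹ ½)

-- Distance to the nearest integer and the upper bound for two runners

‖-‖ℚ-≥ : ∀ {q c} j → ℤ⇒ℚ j ℚ.+ c ℚ.≤ q → q ℚ.+ c ℚ.≤ ℤ⇒ℚ j ℚ.+ 1ℚ → c ℚ.≤ ‖ q ‖ℚ
-- No integer lies strictly between `j` and `j + 1`, so `round q` is on one side of that interval,
-- and the hypothesis for that side keeps it at distance at least `c`.
‖-‖ℚ-≥ {q} {c} j j+c≤q q+c≤j+1 with round q ℤ.≤? j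
... | yes k≤j = ℚ.≤-trans
  (shift-≤ (ℚ.≤-trans (ℚ.+-monoˡ-≤ c (ℤ⇒ℚ-mono-≤ k≤j)) j+c≤q)
           (solve 3 (λ q k c → q :- (k :+ c) := (q :- k) :- c) refl q k c))
  (p≤∣p∣ (q ℚ.- k))
  where
  open +-*-Solver
  k = ℤ⇒ℚ (round q)
... | no k≰j = ℚ.≤-trans
  (shift-≤ (ℚ.≤-trans q+c≤j+1 (subst (ℚ._≤ k) (ℚ.+-comm 1ℚ (ℤ⇒ℚ j)) (ℤ⇒ℚ-< (ℤ.≰⇒> k≰j))))
           (solve 3 (λ q k c → k :- (q :+ c) := (k :- q) :- c) refl q k c))
  (subst (k ℚ.- q ℚ.≤_) (∣p-q∣≡∣q-p∣ k q) (p≤∣p∣ (k ℚ.- q)))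
  where
  open +-*-Solver
  k = ℤ⇒ℚ (round q)

-- The norm is at most the distance to any integer; here the integer is `floor q`, and in the next
-- lemma `floor q + 1`.
<‖-‖ℚ⇒floor+< : ∀ q {c} → c ℚ.< ‖ q ‖ℚ → ℤ⇒ℚ (floor q) ℚ.+ c ℚ.< q
<‖-‖ℚ⇒floor+< q {c} c<‖q‖ = shift-<
  (ℚ.<-≤-trans c<‖q‖ (ℚ.≤-trans (‖-‖ℚ-nearest q (floor q))
    (ℚ.≤-reflexive (ℚ.0≤p⇒∣p∣≡p
      (shift-≤ (floor-≤ q) (solve 2 (λ q f → q :- f := (q :- f) :- con 0ℚ) refl q f))))))
  (solve 3 (λ q f c → (q :- f) :- c := q :- (f :+ c)) refl q f c)
  where
  open +-*-Solver
  f = ℤ⇒ℚ (floor q)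

<‖-‖ℚ⇒+<floor+1 : ∀ q {c} → c ℚ.< ‖ q ‖ℚ → q ℚ.+ c ℚ.< ℤ⇒ℚ (floor q) ℚ.+ 1ℚ
<‖-‖ℚ⇒+<floor+1 q {c} c<‖q‖ = shift-<
  (ℚ.<-≤-trans c<‖q‖ (ℚ.≤-trans (‖-‖ℚ-nearest q (floor q ℤ.+ + 1))
    (ℚ.≤-reflexive (trans (cong (λ r → ℚ.∣ q ℚ.- r ∣) (ℤ⇒ℚ-+ (floor q) (+ 1)))
      (trans (∣p-q∣≡∣q-p∣ q f)
      (ℚ.0≤p⇒∣p∣≡p
        (shift-≤ (≤-floor+1 q) (solve 2 (λ q f → f :- q := (f :- q) :- con 0ℚ) refl q f))))))))
  (solve 3 (λ q f c → (f :- q) :- c := f :- (q :+ c)) refl q f c)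
  where
  open +-*-Solver
  f = ℤ⇒ℚ (floor q) ℚ.+ 1ℚ

-- With `c = val h`, add `b` times `pa + c < ⌊pa⌋ + 1` to `a` times `⌊pb⌋ + c < pb`. The terms `pab`
-- cancel and `c (a + b) = h`, so only integers remain.
floor-gap : ∀ a b h p .{{_ : ℕ.NonZero a}} .{{_ : ℕ.NonZero b}} → a ℕ.+ b ≡ suc (2 ℕ.* h) →
            val h ℚ.< ‖ p ℚ.* fromℕ a ‖ℚ → val h ℚ.< ‖ p ℚ.* fromℕ b ‖ℚ →
            + h ℤ.+ + a ℤ.* floor (p ℚ.* fromℕ b) ℤ.< + b ℤ.* floor (p ℚ.* fromℕ a) ℤ.+ + b
floor-gap a b h p a+b c<₁ c<₂ = ℤ⇒ℚ-cancel-< (subst₂ ℚ._<_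
  (sym (trans (ℤ⇒ℚ-+ (+ h) (+ a ℤ.* ⌊pb⌋)) (cong₂ ℚ._+_ h≡ (ℤ⇒ℚ-* (+ a) ⌊pb⌋))))
  (sym (trans (ℤ⇒ℚ-+ (+ b ℤ.* ⌊pa⌋) (+ b)) (cong (ℚ._+ B) (ℤ⇒ℚ-* (+ b) ⌊pa⌋))))
  (shift-< (ℚ.+-mono-< (ℚ.*-monoʳ-<-pos B {{fromℕ-pos b}} (<‖-‖ℚ⇒+<floor+1 (p ℚ.* A) c<₁))
                       (ℚ.*-monoʳ-<-pos A {{fromℕ-pos a}} (<‖-‖ℚ⇒floor+< (p ℚ.* B) c<₂)))
    (solve 6 (λ A B p c f g →
       (B :* (f :+ con 1ℚ) :+ A :* (p :* B)) :- (B :* (p :* A :+ c) :+ A :* (g :+ c)) :=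
       (B :* f :+ B) :- (c :* (A :+ B) :+ A :* g))
       refl A B p (val h) (ℤ⇒ℚ ⌊pa⌋) (ℤ⇒ℚ ⌊pb⌋))))
  where
  open +-*-Solver
  A = fromℕ a
  B = fromℕ b
  ⌊pa⌋ = floor (p ℚ.* A)
  ⌊pb⌋ = floor (p ℚ.* B)
  h≡ : fromℕ h ≡ val h ℚ.* (A ℚ.+ B)
  h≡ = trans (sym (val-* h)) (cong (val h ℚ.*_)
         (trans (cong fromℕ (sym a+b)) (ℤ⇒ℚ-+ (+ a) (+ b))))

-- For `D = b⌊pa⌋ - a⌊pb⌋`, the gap inequality in both orders gives `h - b < D < a - h`. Since
-- `a - h = h - b + 1`, no integer `D` fits.
min-≤-val : ∀ a b h p .{{_ : ℕ.NonZero a}} .{{_ : ℕ.NonZero b}} → a ℕ.+ b ≡ suc (2 ℕ.* h) →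
            ‖ p ℚ.* fromℕ a ‖ℚ ℚ.⊓ ‖ p ℚ.* fromℕ b ‖ℚ ℚ.≤ val h
min-≤-val a b h p a+b = ℚ.≮⇒≥ λ val< →
  let val<₁ = ℚ.<-≤-trans val< (ℚ.p⊓q≤p ‖ p ℚ.* fromℕ a ‖ℚ ‖ p ℚ.* fromℕ b ‖ℚ)
      val<₂ = ℚ.<-≤-trans val< (ℚ.p⊓q≤q ‖ p ℚ.* fromℕ a ‖ℚ ‖ p ℚ.* fromℕ b ‖ℚ)
      af = + a ℤ.* floor (p ℚ.* fromℕ b)
      bf = + b ℤ.* floor (p ℚ.* fromℕ a)
      -- Each strict inequality between integers gains 1. Once the floor terms cancel, the sum reads
      -- `2 + 2h ≤ a + b`, against `a + b = 2h + 1`.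
      2+2h≤a+b = ℤ.+-mono-≤
        (ℤ.i<j⇒suc[i]≤j (floor-gap a b h p a+b val<₁ val<₂))
        (ℤ.i<j⇒suc[i]≤j (floor-gap b a h p (trans (ℕ.+-comm b a) a+b) val<₂ val<₁))
  in ℕ.<-irrefl (sym a+b) (ℤ.drop‿+≤+ (subst₂ ℤ._≤_
       (trans (solve 3 (λ h x y → (con (+ 1) :+ (h :+ x)) :+ (con (+ 1) :+ (h :+ y)) :+ (:- (x :+ y)) :=
                  con (+ 1) :+ (con (+ 1) :+ con (+ 2) :* h)) refl (+ h) af bf)
              (cong (λ i → + 1 ℤ.+ (+ 1 ℤ.+ i)) (sym (ℤ.pos-* 2 h))))
       (trans (solve 4 (λ a b x y → (y :+ b) :+ (x :+ a) :+ (:- (x :+ y)) := a :+ b) refl (+ a) (+ b) af bf)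
              (sym (ℤ.pos-+ a b)))
       (ℤ.+-monoˡ-≤ (ℤ.- (af ℤ.+ bf)) 2+2h≤a+b)))
  where open ℤSolver.+-*-Solver

-- Times at which the bounds are attained

½≤‖1/2d*[2a+1]d‖ : ∀ d a .{{_ : ℕ.NonZero (2 ℕ.* d)}} →
                   ½ ℚ.≤ ‖ (+ 1 ℚ./ (2 ℕ.* d)) ℚ.* fromℕ (suc (2 ℕ.* a) ℕ.* d) ‖ℚ
½≤‖1/2d*[2a+1]d‖ d a = ‖-‖ℚ-≥ (+ a)
  (ℚ.≤-reflexive (sym q≡))
  (ℚ.≤-reflexive (trans (cong (ℚ._+ ½) q≡) (ℚ.+-assoc (fromℕ a) ½ ½)))
  where
  open +-*-Solver
  t = + 1 ℚ./ (2 ℕ.* d)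
  q≡ : t ℚ.* fromℕ (suc (2 ℕ.* a) ℕ.* d) ≡ fromℕ a ℚ.+ ½
  -- The runner stands midway between `a` and `a + 1`. Multiplying by 2 completes `d` to the
  -- denominator `2d` of `t`.
  q≡ = *-cancelʳ-pos (fromℕ 2) {{fromℕ-pos 2}} (trans
    (cong (λ x → t ℚ.* x ℚ.* fromℕ 2) (trans (fromℕ-* (suc (2 ℕ.* a)) d) (cong (ℚ._* fromℕ d) (2h+1 a))))
    (trans (solve 4 (λ t a d n → t :* ((con 1ℚ :+ (con 1ℚ :+ con 1ℚ) :* a) :* d) :* n :=
                                 t :* (n :* d) :* (con 1ℚ :+ (con 1ℚ :+ con 1ℚ) :* a))
                  refl t (fromℕ a) (fromℕ d) (fromℕ 2))
    (trans (cong (ℚ._* _) (trans (cong (t ℚ.*_) (sym (fromℕ-* 2 d))) (i/n*n≡i (+ 1) (2 ℕ.* d))))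
           (solve 1 (λ a → con 1ℚ :* (con 1ℚ :+ (con 1ℚ :+ con 1ℚ) :* a) :=
                           (a :+ con ½) :* con (fromℕ 2)) refl (fromℕ a)))))

-- Since `q = k + 1 - c`, the claim is `2c ≤ 1`.
k+c≤q : ∀ k c q → c ℚ.≤ ½ → q ℚ.+ c ≡ k ℚ.+ 1ℚ → k ℚ.+ c ℚ.≤ q
k+c≤q k c q c≤½ q+c≡k+1 = shift-≤ (ℚ.+-mono-≤ c≤½ c≤½) (begin
  1ℚ ℚ.- (c ℚ.+ c)                       ≡⟨ solve 2 (λ c k → con 1ℚ :- (c :+ c) := (k :+ con 1ℚ) :- (k :+ c :+ c)) refl c k ⟩
  (k ℚ.+ 1ℚ) ℚ.- (k ℚ.+ c ℚ.+ c)         ≡⟨ cong (ℚ._- (k ℚ.+ c ℚ.+ c)) q+c≡k+1 ⟨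
  (q ℚ.+ c) ℚ.- (k ℚ.+ c ℚ.+ c)          ≡⟨ solve 3 (λ q c k → (q :+ c) :- (k :+ c :+ c) := q :- (k :+ c)) refl q c k ⟩
  q ℚ.- (k ℚ.+ c)                        ∎)
  where
  open ≡-Reasoning
  open +-*-Solver

-- From `rb = rs - ra`, the residue `h` of `ra` modulo `s` turns into `-h` for `rb`. The multiplier
-- is kept as `k + 1` with `k = r - j - 1`, because the second runner will lie between `k` and
-- `k + 1`.
complementary-residue : ∀ r a b h j s → a ℤ.+ b ≡ s → r ℤ.* a ≡ h ℤ.+ j ℤ.* s →
                        r ℤ.* b ℤ.+ h ≡ (r ℤ.- j ℤ.- + 1 ℤ.+ + 1) ℤ.* s
complementary-residue r a b h j s a+b ra = begin
  r ℤ.* b ℤ.+ h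
    ≡⟨ solve 4 (λ r a b h → r :* b :+ h := r :* (a :+ b) :- (r :* a :- h)) refl r a b h ⟩
  r ℤ.* (a ℤ.+ b) ℤ.- (r ℤ.* a ℤ.- h)
    ≡⟨ cong₂ (λ x y → r ℤ.* x ℤ.- (y ℤ.- h)) a+b ra ⟩
  r ℤ.* s ℤ.- (h ℤ.+ j ℤ.* s ℤ.- h)
    ≡⟨ solve 4 (λ r h j s → r :* s :- (h :+ j :* s :- h) := (r :- j :- con (+ 1) :+ con (+ 1)) :* s) refl r h j s ⟩
  (r ℤ.- j ℤ.- + 1 ℤ.+ + 1) ℤ.* s ∎
  where
  open ≡-Reasoning
  open ℤSolver.+-*-Solver

module _ (d a b h : ℕ) (r j : ℤ) (t : ℚ) (t≡r/sd : t ℚ.* fromℕ (suc (2 ℕ.* h) ℕ.* d) ≡ ℤ⇒ℚ r)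
         (a+b : a ℕ.+ b ≡ suc (2 ℕ.* h)) (ra : r ℤ.* + a ≡ + h ℤ.+ j ℤ.* + suc (2 ℕ.* h)) where

  private
    s : ℕ
    s = suc (2 ℕ.* h)

  -- The factor `s` completes `d` to the denominator `sd` of `t`: measured in units of `1/s`, the
  -- runner of speed `md` is at the integer `rm`.
  t*-scaled : ∀ m → t ℚ.* fromℕ (m ℕ.* d) ℚ.* fromℕ s ≡ ℤ⇒ℚ (r ℤ.* + m)
  t*-scaled m = trans
    (cong (λ x → t ℚ.* x ℚ.* fromℕ s) (fromℕ-* m d))
    (trans (solve 4 (λ t m d s → t :* (m :* d) :* s := t :* (s :* d) :* m) refl t (fromℕ m) (fromℕ d) (fromℕ s))
    (trans (cong (ℚ._* fromℕ m) (trans (cong (t ℚ.*_) (sym (fromℕ-* s d))) t≡r/sd))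
           (sym (ℤ⇒ℚ-* r (+ m)))))
    where open +-*-Solver

  -- This runner is at `j + h/s`, and `h/s < ½` keeps it at least as far from `j + 1`.
  val≤‖ta‖ : val h ℚ.≤ ‖ t ℚ.* fromℕ (a ℕ.* d) ‖ℚ
  val≤‖ta‖ = ‖-‖ℚ-≥ j (ℚ.≤-reflexive (sym ta≡))
    (subst (λ q → q ℚ.+ val h ℚ.≤ ℤ⇒ℚ j ℚ.+ 1ℚ) (sym ta≡)
      (subst (ℚ._≤ ℤ⇒ℚ j ℚ.+ 1ℚ) (sym (ℚ.+-assoc (ℤ⇒ℚ j) (val h) (val h)))
        (ℚ.+-monoʳ-≤ (ℤ⇒ℚ j) (ℚ.+-mono-≤ (ℚ.<⇒≤ (val<½ h)) (ℚ.<⇒≤ (val<½ h))))))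
    where
    ta≡ : t ℚ.* fromℕ (a ℕ.* d) ≡ ℤ⇒ℚ j ℚ.+ val h
    ta≡ = *-cancelʳ-pos (fromℕ s) {{fromℕ-pos s}} (begin
      t ℚ.* fromℕ (a ℕ.* d) ℚ.* fromℕ s          ≡⟨ t*-scaled a ⟩
      ℤ⇒ℚ (r ℤ.* + a)                            ≡⟨ cong ℤ⇒ℚ (trans ra (ℤ.+-comm (+ h) (j ℤ.* + s))) ⟩
      ℤ⇒ℚ (j ℤ.* + s ℤ.+ + h)                    ≡⟨ ℤ⇒ℚ-+ (j ℤ.* + s) (+ h) ⟩
      ℤ⇒ℚ (j ℤ.* + s) ℚ.+ fromℕ h                ≡⟨ cong₂ ℚ._+_ (ℤ⇒ℚ-* j (+ s)) (sym (val-* h)) ⟩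
      ℤ⇒ℚ j ℚ.* fromℕ s ℚ.+ val h ℚ.* fromℕ s    ≡⟨ ℚ.*-distribʳ-+ (fromℕ s) (ℤ⇒ℚ j) (val h) ⟨
      (ℤ⇒ℚ j ℚ.+ val h) ℚ.* fromℕ s              ∎)
      where open ≡-Reasoning

  -- The mirror image: this runner is at `k + 1 - h/s`.
  val≤‖tb‖ : val h ℚ.≤ ‖ t ℚ.* fromℕ (b ℕ.* d) ‖ℚ
  val≤‖tb‖ = ‖-‖ℚ-≥ k (k+c≤q (ℤ⇒ℚ k) (val h) q (ℚ.<⇒≤ (val<½ h)) tb≡) (ℚ.≤-reflexive tb≡)
    where
    k = r ℤ.- j ℤ.- + 1
    q = t ℚ.* fromℕ (b ℕ.* d)
    rb : r ℤ.* + b ℤ.+ + h ≡ (k ℤ.+ + 1) ℤ.* + s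
    rb = complementary-residue r (+ a) (+ b) (+ h) j (+ s) (trans (sym (ℤ.pos-+ a b)) (cong +_ a+b)) ra
    tb≡ : q ℚ.+ val h ≡ ℤ⇒ℚ k ℚ.+ 1ℚ
    tb≡ = *-cancelʳ-pos (fromℕ s) {{fromℕ-pos s}} (begin
      (q ℚ.+ val h) ℚ.* fromℕ s                 ≡⟨ ℚ.*-distribʳ-+ (fromℕ s) q (val h) ⟩
      q ℚ.* fromℕ s ℚ.+ val h ℚ.* fromℕ s       ≡⟨ cong₂ ℚ._+_ (t*-scaled b) (val-* h) ⟩
      ℤ⇒ℚ (r ℤ.* + b) ℚ.+ fromℕ h               ≡⟨ ℤ⇒ℚ-+ (r ℤ.* + b) (+ h) ⟨
      ℤ⇒ℚ (r ℤ.* + b ℤ.+ + h)                   ≡⟨ cong ℤ⇒ℚ rb ⟩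
      ℤ⇒ℚ ((k ℤ.+ + 1) ℤ.* + s)                 ≡⟨ ℤ⇒ℚ-* (k ℤ.+ + 1) (+ s) ⟩
      ℤ⇒ℚ (k ℤ.+ + 1) ℚ.* fromℕ s               ≡⟨ cong (ℚ._* fromℕ s) (ℤ⇒ℚ-+ k (+ 1)) ⟩
      (ℤ⇒ℚ k ℚ.+ 1ℚ) ℚ.* fromℕ s                ∎)
      where open ≡-Reasoning

-- The Bézout identity for `a` and `n`, multiplied by `h`. Its coefficients are naturals, so the
-- identity comes in two sign patterns, and the second needs negated witnesses.
bézout-residue : ∀ {a n} h → Coprime a n → ∃[ r ] ∃[ j ] r ℤ.* + a ≡ + h ℤ.+ j ℤ.* + n
bézout-residue {a} {n} h c with coprime-Bézout c
... | Bézout.+- x y eq = + h ℤ.* + x , + h ℤ.* + y , (begin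
  + h ℤ.* + x ℤ.* + a              ≡⟨ ℤ.*-assoc (+ h) (+ x) (+ a) ⟩
  + h ℤ.* (+ x ℤ.* + a)            ≡⟨ cong (+ h ℤ.*_) eqℤ ⟨
  + h ℤ.* (+ 1 ℤ.+ + y ℤ.* + n)    ≡⟨ solve 3 (λ h y n → h :* (con (+ 1) :+ y :* n) := h :+ h :* y :* n) refl (+ h) (+ y) (+ n) ⟩
  + h ℤ.+ + h ℤ.* + y ℤ.* + n      ∎)
  where
  open ≡-Reasoning
  open ℤSolver.+-*-Solver
  eqℤ : + 1 ℤ.+ + y ℤ.* + n ≡ + x ℤ.* + a
  eqℤ = trans (cong (λ z → + 1 ℤ.+ z) (sym (ℤ.pos-* y n))) (trans (cong +_ eq) (ℤ.pos-* x a))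
... | Bézout.-+ x y eq = ℤ.- (+ h ℤ.* + x) , ℤ.- (+ h ℤ.* + y) , (begin
  ℤ.- (+ h ℤ.* + x) ℤ.* + a
    ≡⟨ solve 3 (λ h x a → :- (h :* x) :* a := h :- h :* (con (+ 1) :+ x :* a)) refl (+ h) (+ x) (+ a) ⟩
  + h ℤ.- + h ℤ.* (+ 1 ℤ.+ + x ℤ.* + a)
    ≡⟨ cong (λ z → + h ℤ.- + h ℤ.* z) eqℤ ⟩
  + h ℤ.- + h ℤ.* (+ y ℤ.* + n)
    ≡⟨ solve 3 (λ h y n → h :- h :* (y :* n) := h :+ (:- (h :* y)) :* n) refl (+ h) (+ y) (+ n) ⟩
  + h ℤ.+ (ℤ.- (+ h ℤ.* + y)) ℤ.* + n ∎)
  where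
  open ≡-Reasoning
  open ℤSolver.+-*-Solver
  eqℤ : + 1 ℤ.+ + x ℤ.* + a ≡ + y ℤ.* + n
  eqℤ = trans (cong (λ z → + 1 ℤ.+ z) (sym (ℤ.pos-* x a))) (trans (cong +_ eq) (ℤ.pos-* y n))

-- Order and equality of Cauchy reals

≃-sym : ∀ {x y} → x ≃ y → y ≃ x
≃-sym {x} {y} x≃y ε 0<ε with x≃y ε 0<ε
... | N , close = N , λ n N≤n → subst (ℚ._< ε) (∣p-q∣≡∣q-p∣ (seq x n) (seq y n)) (close n N≤n)

≃⇒≤ : ∀ {x y} → x ≃ y → x ≤ y
≃⇒≤ {x} {y} x≃y ε 0<ε with x≃y ε 0<ε
... | N , close = N , λ n N≤n → ∣p-q∣<ε⇒p<q+ε (seq x n) (seq y n) (close n N≤n)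

≤-antisym : ∀ {x y} → x ≤ y → y ≤ x → x ≃ y
≤-antisym x≤y y≤x ε 0<ε with x≤y ε 0<ε | y≤x ε 0<ε
... | M , x< | N , y< = M ℕ.⊔ N , λ n M⊔N≤n →
  ∣-∣<-intro (x< n (ℕ.m⊔n≤o⇒m≤o M N M⊔N≤n)) (y< n (ℕ.m⊔n≤o⇒n≤o M N M⊔N≤n))

+½+½ : ∀ p q r ε → p ℚ.< q ℚ.+ ½ ℚ.* ε → q ℚ.< r ℚ.+ ½ ℚ.* ε → p ℚ.< r ℚ.+ ε
+½+½ p q r ε p< q< = ℚ.<-trans p<
  (subst (q ℚ.+ ½ ℚ.* ε ℚ.<_)
    (trans (ℚ.+-assoc r (½ ℚ.* ε) (½ ℚ.* ε)) (cong (r ℚ.+_) (half+half ε)))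
    (ℚ.+-monoˡ-< (½ ℚ.* ε) q<))

-- Perturbing one end of a gap `ε` by less than half of it leaves the other half as a gap. This is
-- what makes strict inequality between reals compose with `_≤_`.
gap-½ʳ : ∀ p q r ε → p ℚ.+ ε ℚ.< q → q ℚ.< r ℚ.+ ½ ℚ.* ε → p ℚ.+ ½ ℚ.* ε ℚ.< r
gap-½ʳ p q r ε p+ε<q q< = shift-< (ℚ.<-trans p+ε<q q<)
  (trans (cong (λ e → r ℚ.+ ½ ℚ.* ε ℚ.- (p ℚ.+ e)) (sym (half+half ε)))
         (solve 3 (λ p r e → r :+ e :- (p :+ (e :+ e)) := r :- (p :+ e)) refl p r (½ ℚ.* ε)))
  where open +-*-Solver

gap-½ˡ : ∀ p q r ε → p ℚ.< q ℚ.+ ½ ℚ.* ε → q ℚ.+ ε ℚ.< r → p ℚ.+ ½ ℚ.* ε ℚ.< r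
gap-½ˡ p q r ε p< q+ε<r = ℚ.<-trans
  (subst (p ℚ.+ ½ ℚ.* ε ℚ.<_)
    (trans (ℚ.+-assoc q (½ ℚ.* ε) (½ ℚ.* ε)) (cong (q ℚ.+_) (half+half ε)))
    (ℚ.+-monoˡ-< (½ ℚ.* ε) p<))
  q+ε<r

≤-trans : ∀ {x y z} → x ≤ y → y ≤ z → x ≤ z
≤-trans {x} {y} {z} x≤y y≤z ε 0<ε with x≤y (½ ℚ.* ε) (half-pos 0<ε) | y≤z (½ ℚ.* ε) (half-pos 0<ε)
... | M , x< | N , y< = M ℕ.⊔ N , λ n M⊔N≤n →
  +½+½ (seq x n) (seq y n) (seq z n) ε (x< n (ℕ.m⊔n≤o⇒m≤o M N M⊔N≤n)) (y< n (ℕ.m⊔n≤o⇒n≤o M N M⊔N≤n))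

<-≤-trans : ∀ {x y z} → x < y → y ≤ z → x < z
<-≤-trans {x} {y} {z} (ε , 0<ε , M , x<) y≤z with y≤z (½ ℚ.* ε) (half-pos 0<ε)
... | N , y< = ½ ℚ.* ε , half-pos 0<ε , M ℕ.⊔ N , λ n M⊔N≤n →
  gap-½ʳ (seq x n) (seq y n) (seq z n) ε (x< n (ℕ.m⊔n≤o⇒m≤o M N M⊔N≤n)) (y< n (ℕ.m⊔n≤o⇒n≤o M N M⊔N≤n))

≤-<-trans : ∀ {x y z} → x ≤ y → y < z → x < z
≤-<-trans {x} {y} {z} x≤y (ε , 0<ε , N , y<) with x≤y (½ ℚ.* ε) (half-pos 0<ε)
... | M , x< = ½ ℚ.* ε , half-pos 0<ε , M ℕ.⊔ N , λ n M⊔N≤n →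
  gap-½ˡ (seq x n) (seq y n) (seq z n) ε (x< n (ℕ.m⊔n≤o⇒m≤o M N M⊔N≤n)) (y< n (ℕ.m⊔n≤o⇒n≤o M N M⊔N≤n))

≃-trans : ∀ {x y z} → x ≃ y → y ≃ z → x ≃ z
≃-trans {x} {y} {z} x≃y y≃z = ≤-antisym {x} {z}
  (≤-trans {x} {y} {z} (≃⇒≤ {x} {y} x≃y) (≃⇒≤ {y} {z} y≃z))
  (≤-trans {z} {y} {x} (≃⇒≤ {z} {y} (≃-sym {y} {z} y≃z)) (≃⇒≤ {y} {x} (≃-sym {x} {y} x≃y)))

seq-≤⇒≤ : ∀ {x y} → (∀ n → seq x n ℚ.≤ seq y n) → x ≤ y
seq-≤⇒≤ {x} {y} x≤y ε 0<ε = 0 , λ n _ → ℚ.≤-<-trans (x≤y n) (p<p+ε (seq y n) 0<ε)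

fromℚ-mono-< : ∀ {p q} → p ℚ.< q → fromℚ p < fromℚ q
fromℚ-mono-< {p} {q} p<q = ½ ℚ.* (q ℚ.- p) , half-pos 0<q-p , 0 , λ _ _ →
  subst (p ℚ.+ ½ ℚ.* (q ℚ.- p) ℚ.<_)
    (trans (ℚ.+-assoc p _ _) (trans (cong (p ℚ.+_) (half+half (q ℚ.- p)))
      (solve 2 (λ p q → p :+ (q :- p) := q) refl p q)))
    (p<p+ε (p ℚ.+ ½ ℚ.* (q ℚ.- p)) (half-pos 0<q-p))
  where
  open +-*-Solver
  0<q-p : 0ℚ ℚ.< q ℚ.- p
  0<q-p = shift-< p<q (solve 2 (λ p q → q :- p := (q :- p) :- con 0ℚ) refl p q)

fromℚ-cancel-< : ∀ {p q} → fromℚ p < fromℚ q → p ℚ.< q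
fromℚ-cancel-< {p} (ε , 0<ε , N , p+ε<q) = ℚ.<-trans (p<p+ε p 0<ε) (p+ε<q N ℕ.≤-refl)

<-resp-≃ : ∀ {x y p q} → x ≃ fromℚ p → y ≃ fromℚ q → x < y → p ℚ.< q
<-resp-≃ {x} {y} {p} {q} x≃p y≃q x<y = fromℚ-cancel-<
  (≤-<-trans {fromℚ p} {x} {fromℚ q} (≃⇒≤ {fromℚ p} {x} (≃-sym {x} {fromℚ p} x≃p))
    (<-≤-trans {x} {y} {fromℚ q} x<y (≃⇒≤ {y} {fromℚ q} y≃q)))

-- Limits of sequences of reals

module _ {x : ℕ → ℝ} {A : ℝ} (x→A : x ConvergesTo A) where

  eventually-near : ∀ ε → 0ℚ ℚ.< ε → ∃[ k ] ∃[ N ] ∀ n → N ℕ.≤ n → ℚ.∣ seq (x k) n ℚ.- seq A n ∣ ℚ.< ε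
  eventually-near ε 0<ε with x→A ε 0<ε
  ... | k , near with near k ℕ.≤-refl
  ...   | δ , 0<δ , N , d<ε = k , N , λ n N≤n → ℚ.<-trans (p<p+ε ℚ.∣ seq (x k) n ℚ.- seq A n ∣ 0<δ) (d<ε n N≤n)

  limit-≤ : ∀ {B} → (∀ k → x k ≤ B) → A ≤ B
  limit-≤ {B} x≤B ε 0<ε with eventually-near (½ ℚ.* ε) (half-pos 0<ε)
  ... | k , M , near with x≤B k (½ ℚ.* ε) (half-pos 0<ε)
  ...   | N , x< = M ℕ.⊔ N , λ n M⊔N≤n →
    +½+½ (seq A n) (seq (x k) n) (seq B n) ε (∣p-q∣<ε⇒q<p+ε (seq (x k) n) (seq A n) (near n (ℕ.m⊔n≤o⇒m≤o M N M⊔N≤n))) (x< n (ℕ.m⊔n≤o⇒n≤o M N M⊔N≤n))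

  -- A term within half the gap between `y` and `A` of the limit still exceeds `y`.
  <limit⇒<term : ∀ {y} → y < A → ∃[ k ] y < x k
  <limit⇒<term {y} (ε , 0<ε , M , y<) with eventually-near (½ ℚ.* ε) (half-pos 0<ε)
  ... | k , N , near = k , ½ ℚ.* ε , half-pos 0<ε , M ℕ.⊔ N , λ n M⊔N≤n →
    gap-½ʳ (seq y n) (seq A n) (seq (x k) n) ε (y< n (ℕ.m⊔n≤o⇒m≤o M N M⊔N≤n)) (∣p-q∣<ε⇒q<p+ε (seq (x k) n) (seq A n) (near n (ℕ.m⊔n≤o⇒n≤o M N M⊔N≤n)))

  limit<⇒term< : ∀ {y} → A < y → ∃[ k ] x k < y
  limit<⇒term< {y} (ε , 0<ε , M , <y) with eventually-near (½ ℚ.* ε) (half-pos 0<ε)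
  ... | k , N , near = k , ½ ℚ.* ε , half-pos 0<ε , M ℕ.⊔ N , λ n M⊔N≤n →
    gap-½ˡ (seq (x k) n) (seq A n) (seq y n) ε (∣p-q∣<ε⇒p<q+ε (seq (x k) n) (seq A n) (near n (ℕ.m⊔n≤o⇒n≤o M N M⊔N≤n))) (<y n (ℕ.m⊔n≤o⇒m≤o M N M⊔N≤n))

-- Computing ML for one and two runners

IsMax-unique : ∀ {f M M′} → IsMax f M → IsMax f M′ → M ≃ M′
IsMax-unique {f} {M} {M′} ((t , ft≃M) , f≤M) ((t′ , ft′≃M′) , f≤M′) = ≤-antisym {M} {M′}
  (≤-trans {M} {f t} {M′} (≃⇒≤ {M} {f t} (≃-sym {f t} {M} ft≃M)) (f≤M′ t))
  (≤-trans {M′} {f t′} {M} (≃⇒≤ {M′} {f t′} (≃-sym {f t′} {M′} ft′≃M′)) (f≤M t′))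

-- Each maximum is attained, hence bounded by the other. Through this an arbitrary real member of
-- `𝓢` is identified with the rational computed from its speeds.
IsML-unique : ∀ n .{{_ : ℕ.NonZero n}} v M M′ → IsML n v M → IsML n v M′ → M ≃ M′
IsML-unique n v M M′ = IsMax-unique {λ t → min n λ i → ‖ t · v i ‖} {M} {M′}

IsML-resp-≃ : ∀ n .{{_ : ℕ.NonZero n}} v M M′ → M ≃ M′ → IsML n v M → IsML n v M′
IsML-resp-≃ n v M M′ M≃M′ ((t , ft≃M) , f≤M) =
  (t , ≃-trans {f t} {M} {M′} ft≃M M≃M′) , λ u → ≤-trans {f u} {M} {M′} (f≤M u) (≃⇒≤ {M} {M′} M≃M′)
  where
  f : ℝ → ℝ
  f t = min n λ i → ‖ t · v i ‖

IsML₁ : ∀ v → 0 ℕ.< v zero → IsML 1 v (fromℚ ½)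
IsML₁ v 0<v = (fromℚ t , ≤-antisym {‖ fromℚ t · v zero ‖} {fromℚ ½} (bound (fromℚ t)) (seq-≤⇒≤ {fromℚ ½} {‖ fromℚ t · v zero ‖} λ _ → attained)) , bound
  where
  instance
    v≢0 : ℕ.NonZero (v zero)
    v≢0 = ℕ.>-nonZero 0<v
    2v≢0 : ℕ.NonZero (2 ℕ.* v zero)
    2v≢0 = ℕ.m*n≢0 2 (v zero)
  t = + 1 ℚ./ (2 ℕ.* v zero)
  bound : ∀ t → ‖ t · v zero ‖ ≤ fromℚ ½
  bound t = seq-≤⇒≤ {‖ t · v zero ‖} {fromℚ ½} λ n → ‖-‖ℚ-≤½ (seq t n ℚ.* fromℕ (v zero))
  attained : ½ ℚ.≤ ‖ t ℚ.* fromℕ (v zero) ‖ℚ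
  -- A single speed `v` is the odd multiple `(2 * 0 + 1) * v` of itself.
  attained = subst (λ m → ½ ℚ.≤ ‖ t ℚ.* fromℕ m ‖ℚ) (ℕ.*-identityˡ (v zero)) (½≤‖1/2d*[2a+1]d‖ (v zero) 0)

-- Rational times suffice for the upper bound: a real time is a sequence of rationals and the
-- minimum of the norms is taken termwise. The maximising time is a constant sequence.
IsML₂ : ∀ v t c →
        (∀ q → ‖ q ℚ.* fromℕ (v zero) ‖ℚ ℚ.⊓ ‖ q ℚ.* fromℕ (v (suc zero)) ‖ℚ ℚ.≤ c) →
        c ℚ.≤ ‖ t ℚ.* fromℕ (v zero) ‖ℚ → c ℚ.≤ ‖ t ℚ.* fromℕ (v (suc zero)) ‖ℚ →
        IsML 2 v (fromℚ c)
IsML₂ v t c upper lower₁ lower₂ =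
  (fromℚ t , ≤-antisym {f (fromℚ t)} {fromℚ c} (bound (fromℚ t))
    (seq-≤⇒≤ {fromℚ c} {f (fromℚ t)} λ _ → ℚ.⊓-glb lower₁ lower₂)) , bound
  where
  f : ℝ → ℝ
  f t = min 2 λ i → ‖ t · v i ‖
  bound : ∀ t → f t ≤ fromℚ c
  bound t = seq-≤⇒≤ {f t} {fromℚ c} λ n → upper (seq t n)

IsML-odd-odd : ∀ v d a b .{{_ : ℕ.NonZero d}} →
               v zero ≡ suc (2 ℕ.* a) ℕ.* d → v (suc zero) ≡ suc (2 ℕ.* b) ℕ.* d →
               IsML 2 v (fromℚ ½)
IsML-odd-odd v d a b v₀ v₁ = IsML₂ v t ½
  (λ q → ℚ.≤-trans (ℚ.p⊓q≤p ‖ q ℚ.* fromℕ (v zero) ‖ℚ _) (‖-‖ℚ-≤½ (q ℚ.* fromℕ (v zero))))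
  (subst (λ m → ½ ℚ.≤ ‖ t ℚ.* fromℕ m ‖ℚ) (sym v₀) (½≤‖1/2d*[2a+1]d‖ d a))
  (subst (λ m → ½ ℚ.≤ ‖ t ℚ.* fromℕ m ‖ℚ) (sym v₁) (½≤‖1/2d*[2a+1]d‖ d b))
  where
  instance
    2d≢0 : ℕ.NonZero (2 ℕ.* d)
    2d≢0 = ℕ.m*n≢0 2 d
  t = + 1 ℚ./ (2 ℕ.* d)

IsML-odd-sum : ∀ v d a b h r j .{{_ : ℕ.NonZero d}} .{{_ : ℕ.NonZero a}} .{{_ : ℕ.NonZero b}} →
               v zero ≡ a ℕ.* d → v (suc zero) ≡ b ℕ.* d → a ℕ.+ b ≡ suc (2 ℕ.* h) →
               r ℤ.* + a ≡ + h ℤ.+ j ℤ.* + suc (2 ℕ.* h) →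
               IsML 2 v (fromℚ (val h))
IsML-odd-sum v d a b h r j v₀ v₁ a+b ra = IsML₂ v t (val h)
  -- Speeds `ad` and `bd` at time `q` give the same positions as speeds `a` and `b` at time `qd`.
  (λ q → subst₂ (λ x y → ‖ x ‖ℚ ℚ.⊓ ‖ y ‖ℚ ℚ.≤ val h) (scale q a v₀) (scale q b v₁)
    (min-≤-val a b h (q ℚ.* fromℕ d) a+b))
  (subst (λ m → val h ℚ.≤ ‖ t ℚ.* fromℕ m ‖ℚ) (sym v₀) (val≤‖ta‖ d a b h r j t (i/n*n≡i r _) a+b ra))
  (subst (λ m → val h ℚ.≤ ‖ t ℚ.* fromℕ m ‖ℚ) (sym v₁) (val≤‖tb‖ d a b h r j t (i/n*n≡i r _) a+b ra))
  where
  instance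
    sd≢0 : ℕ.NonZero (suc (2 ℕ.* h) ℕ.* d)
    sd≢0 = ℕ.m*n≢0 (suc (2 ℕ.* h)) d
  t = r ℚ./ (suc (2 ℕ.* h) ℕ.* d)
  open +-*-Solver
  scale : ∀ q m {w} → w ≡ m ℕ.* d → q ℚ.* fromℕ d ℚ.* fromℕ m ≡ q ℚ.* fromℕ w
  scale q m refl = trans (solve 3 (λ q d m → q :* d :* m := q :* (m :* d)) refl q (fromℕ d) (fromℕ m))
                         (cong (q ℚ.*_) (sym (fromℕ-* m d)))

-- The possible values of ML for two runners

even-or-odd : ∀ n → ∃[ m ] (n ≡ 2 ℕ.* m ⊎ n ≡ suc (2 ℕ.* m))
even-or-odd zero = 0 , inj₁ refl
even-or-odd (suc n) with even-or-odd n
... | m , inj₁ eq = m , inj₂ (cong suc eq)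
... | m , inj₂ eq = suc m , inj₁ (trans (cong suc eq) (sym (ℕ.*-suc 2 m)))

coprime-parity : ∀ a b → Coprime a b →
  (∃[ h ] a ℕ.+ b ≡ suc (2 ℕ.* h)) ⊎ (∃[ a′ ] ∃[ b′ ] a ≡ suc (2 ℕ.* a′) × b ≡ suc (2 ℕ.* b′))
coprime-parity a b c with even-or-odd a | even-or-odd b
... | m , inj₁ refl | n , inj₁ refl =
  -- With both even, 2 is a common divisor and coprimality would give `2 ≡ 1`.
  contradiction (c {2} (divides m (ℕ.*-comm 2 m) , divides n (ℕ.*-comm 2 n))) λ ()
... | m , inj₁ refl | n , inj₂ refl = inj₁ (m ℕ.+ n ,
  trans (ℕ.+-suc (2 ℕ.* m) (2 ℕ.* n)) (cong suc (sym (ℕ.*-distribˡ-+ 2 m n))))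
... | m , inj₂ refl | n , inj₁ refl = inj₁ (m ℕ.+ n , cong suc (sym (ℕ.*-distribˡ-+ 2 m n)))
... | m , inj₂ refl | n , inj₂ refl = inj₂ (m , n , refl , refl)

IsML-coprime : ∀ v d a b .{{_ : ℕ.NonZero d}} .{{_ : ℕ.NonZero a}} .{{_ : ℕ.NonZero b}} →
               v zero ≡ a ℕ.* d → v (suc zero) ≡ b ℕ.* d → Coprime a b →
               (∃[ h ] IsML 2 v (fromℚ (val h))) ⊎ IsML 2 v (fromℚ ½)
IsML-coprime v d a b v₀ v₁ a⊥b = [ odd-sum , odd-odd ]′ (coprime-parity a b a⊥b)
  where
  odd-sum : (∃[ h ] a ℕ.+ b ≡ suc (2 ℕ.* h)) →
            (∃[ h ] IsML 2 v (fromℚ (val h))) ⊎ IsML 2 v (fromℚ ½)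
  odd-sum (h , a+b) =
    -- Being coprime to `b`, the speed `a` is coprime to `a + b = 2h + 1`, so `ra ≡ h` is solvable
    -- modulo `2h + 1`.
    let r , j , ra = bézout-residue h
          (Coprimality.sym (subst (λ n → Coprime n a) a+b (coprime-+ (Coprimality.sym a⊥b))))
    in inj₁ (h , IsML-odd-sum v d a b h r j v₀ v₁ a+b ra)
  odd-odd : (∃[ a′ ] ∃[ b′ ] a ≡ suc (2 ℕ.* a′) × b ≡ suc (2 ℕ.* b′)) →
            (∃[ h ] IsML 2 v (fromℚ (val h))) ⊎ IsML 2 v (fromℚ ½)
  odd-odd (a′ , b′ , a≡ , b≡) = inj₂ (IsML-odd-odd v d a′ b′
    (trans v₀ (cong (ℕ._* d) a≡)) (trans v₁ (cong (ℕ._* d) b≡)))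

positive-factor : ∀ {n} m d → 0 ℕ.< n → n ≡ m ℕ.* d → ℕ.NonZero m
positive-factor (suc _) _ _ _ = _
positive-factor zero _ () refl

-- Dividing by the gcd leaves a coprime pair, whose maximum is known. Both accumulation arguments
-- rest on this dichotomy.
𝓢₂-values : ∀ {M} → 𝓢 2 M → (∃[ h ] M ≃ fromℚ (val h)) ⊎ M ≃ fromℚ ½
𝓢₂-values {M} (v , v>0 , ml) =
  [ (λ (h , ml′) → inj₁ (h , IsML-unique 2 v M (fromℚ (val h)) ml ml′))
  , (λ ml′ → inj₂ (IsML-unique 2 v M (fromℚ ½) ml ml′))
  ]′ (IsML-coprime v d (v₀ ℕ./ d) (v₁ ℕ./ d) v₀≡ v₁≡ (coprime-/gcd v₀ v₁))
  where
  v₀ v₁ d : ℕ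
  v₀ = v zero
  v₁ = v (suc zero)
  d = gcd v₀ v₁
  instance
    d≢0 : ℕ.NonZero d
    d≢0 = ℕ.≢-nonZero (gcd[m,n]≢0 v₀ v₁ (inj₁ (ℕ.>⇒≢ (v>0 zero))))
  v₀≡ : v₀ ≡ v₀ ℕ./ d ℕ.* d
  v₀≡ = sym (ℕ.m/n*n≡m (gcd[m,n]∣m v₀ v₁))
  v₁≡ : v₁ ≡ v₁ ℕ./ d ℕ.* d
  v₁≡ = sym (ℕ.m/n*n≡m (gcd[m,n]∣n v₀ v₁))
  instance
    v₀/d≢0 : ℕ.NonZero (v₀ ℕ./ d)
    v₀/d≢0 = positive-factor (v₀ ℕ./ d) d (v>0 zero) v₀≡
    v₁/d≢0 : ℕ.NonZero (v₁ ℕ./ d)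
    v₁/d≢0 = positive-factor (v₁ ℕ./ d) d (v>0 (suc zero)) v₁≡

-- Speeds 1 and `2n` with `n = suc h` have sum `2n + 1`, and `r = n`, `j = 0` solve the congruence
-- at once. The successor keeps the second speed positive.
val∈𝓢₂ : ∀ h → 𝓢 2 (fromℚ (val (suc h)))
val∈𝓢₂ h = v , v>0 , IsML-odd-sum v 1 1 (2 ℕ.* suc h) (suc h) (+ suc h) (+ 0)
  refl (sym (ℕ.*-identityʳ (2 ℕ.* suc h))) refl
  (trans (ℤ.*-identityʳ (+ suc h)) (sym (ℤ.+-identityʳ (+ suc h))))
  where
  v : Fin 2 → ℕ
  v zero = 1
  v (suc zero) = 2 ℕ.* suc h
  v>0 : ∀ i → 0 ℕ.< v i
  v>0 zero = ℕ.z<s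
  v>0 (suc zero) = ℕ.z<s

-- Lower and upper accumulation points

𝓢₁⇒½ : ∀ {M} → 𝓢 1 M → M ≃ fromℚ ½
𝓢₁⇒½ {M} (v , v>0 , ml) = IsML-unique 1 v M (fromℚ ½) ml (IsML₁ v (v>0 zero))

½⇒𝓢₁ : ∀ {M} → M ≃ fromℚ ½ → 𝓢 1 M
½⇒𝓢₁ {M} M≃½ = (λ _ → 1) , (λ _ → ℕ.z<s) ,
  IsML-resp-≃ 1 (λ _ → 1) (fromℚ ½) M (≃-sym {M} {fromℚ ½} M≃½) (IsML₁ (λ _ → 1) ℕ.z<s)

½⇒lower : ∀ {A} → A ≃ fromℚ ½ → LowerAccumulationPoint 2 A
½⇒lower {A} A≃½ = (λ k → fromℚ (val (suc k))) , val∈𝓢₂ , below , converges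
  where
  below : ∀ k → fromℚ (val (suc k)) < A
  below k = <-≤-trans {fromℚ (val (suc k))} {fromℚ ½} {A} (fromℚ-mono-< (val<½ (suc k)))
    (≃⇒≤ {fromℚ ½} {A} (≃-sym {A} {fromℚ ½} A≃½))
  converges : (λ k → fromℚ (val (suc k))) ConvergesTo A
  -- Half of `ε` is reserved as the gap that strict inequality of reals demands. The other half,
  -- `η`, is split again between the distances of `val (suc k)` and of `A` from `½`.
  converges ε 0<ε = N , λ k N≤k → η , 0<η , M , λ n M≤n →
    subst (ℚ.∣ val (suc k) ℚ.- seq A n ∣ ℚ.+ η ℚ.<_) (half+half ε) (ℚ.+-monoˡ-< η (∣-∣<-intro
      (+½+½ (val (suc k)) ½ (seq A n) η (ℚ.<-trans (val<½ (suc k)) (p<p+ε ½ (half-pos 0<η))) (∣p-q∣<ε⇒q<p+ε (seq A n) ½ (near n M≤n)))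
      (+½+½ (seq A n) ½ (val (suc k)) η (∣p-q∣<ε⇒p<q+ε (seq A n) ½ (near n M≤n)) (large (suc k) (ℕ.m≤n⇒m≤1+n N≤k)))))
    where
    η = ½ ℚ.* ε
    0<η = half-pos 0<ε
    N = proj₁ (½<val+ε (half-pos 0<η))
    large = proj₂ (½<val+ε (half-pos 0<η))
    M = proj₁ (A≃½ (½ ℚ.* η) (half-pos 0<η))
    near = proj₂ (A≃½ (½ ℚ.* η) (half-pos 0<η))

𝓢₂-≤½ : ∀ {M} → 𝓢 2 M → M ≤ fromℚ ½
𝓢₂-≤½ {M} (v , _ , (t , ft≃M) , _) = ≤-trans {M} {f t} {fromℚ ½}
  (≃⇒≤ {M} {f t} (≃-sym {f t} {M} ft≃M))
  (seq-≤⇒≤ {f t} {fromℚ ½} λ n →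
    ℚ.≤-trans (ℚ.p⊓q≤p ‖ seq t n ℚ.* fromℕ (v zero) ‖ℚ _) (‖-‖ℚ-≤½ (seq t n ℚ.* fromℕ (v zero))))
  where
  f : ℝ → ℝ
  f t = min 2 λ i → ‖ t · v i ‖

lower⇒½ : ∀ {A} → LowerAccumulationPoint 2 A → A ≃ fromℚ ½
lower⇒½ {A} (x , x∈𝓢 , x<A , x→A) = ≤-antisym {A} {fromℚ ½}
  (limit-≤ {x} {A} x→A {fromℚ ½} λ k → 𝓢₂-≤½ {x k} (x∈𝓢 k)) ½≤A
  where
  val-≤-term : ∀ h k → (∀ h′ → x k ≃ fromℚ (val h′) → h ℕ.≤ h′) → fromℚ (val h) ≤ x k
  val-≤-term h k h≤ = [ (λ (h′ , x≃val) → ≤-trans {fromℚ (val h)} {fromℚ (val h′)} {x k}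
      (seq-≤⇒≤ {fromℚ (val h)} {fromℚ (val h′)} λ _ → val-mono-≤ (h≤ h′ x≃val))
      (≃⇒≤ {fromℚ (val h′)} {x k} (≃-sym {x k} {fromℚ (val h′)} x≃val)))
    , (λ x≃½ → ≤-trans {fromℚ (val h)} {fromℚ ½} {x k}
      (seq-≤⇒≤ {fromℚ (val h)} {fromℚ ½} λ _ → ℚ.<⇒≤ (val<½ h))
      (≃⇒≤ {fromℚ ½} {x k} (≃-sym {x k} {fromℚ ½} x≃½)))
    ]′ (𝓢₂-values {x k} (x∈𝓢 k))

  -- Given `val h ≤ x k < A`, convergence supplies a term `x k′` above `x k`. It equals `½`, or some
  -- `val h′` with `val h < val h′`, which forces `suc h ≤ h′`.
  climb : ∀ h → ∃[ k ] fromℚ (val h) ≤ x k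
  climb zero = 0 , val-≤-term 0 0 λ _ _ → ℕ.z≤n
  climb (suc h) =
    let k , val≤xk = climb h
        k′ , xk<xk′ = <limit⇒<term {x} {A} x→A {x k} (x<A k)
    in k′ , val-≤-term (suc h) k′ λ h′ xk′≃val →
      val-cancel-< (fromℚ-cancel-<
        (≤-<-trans {fromℚ (val h)} {x k} {fromℚ (val h′)} val≤xk
          (<-≤-trans {x k} {x k′} {fromℚ (val h′)} xk<xk′ (≃⇒≤ {x k′} {fromℚ (val h′)} xk′≃val))))

  ½≤A : fromℚ ½ ≤ A
  ½≤A ε 0<ε =
    -- This `h` has `val h` within `ε` of `½`; climbing to it puts `A` above `val h`.
    let h , large = ½<val+ε 0<ε
        k , val≤xk = climb h
        δ , 0<δ , N , val+δ<A = ≤-<-trans {fromℚ (val h)} {x k} {A} val≤xk (x<A k)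
    in N , λ n N≤n →
      ℚ.<-trans (large h ℕ.≤-refl) (ℚ.+-monoˡ-< ε (ℚ.<-trans (p<p+ε (val h) 0<δ) (val+δ<A n N≤n)))

no-upper : ∀ A → ¬ UpperAccumulationPoint 2 A
no-upper A (x , x∈𝓢 , A<x , x→A) = [ not-val 0 , not-½ 0 ]′ (𝓢₂-values {x 0} (x∈𝓢 0))
  where
  -- Because `A < x k`, some term lies strictly below `x k`. It cannot be `½`, so it is `val h′`
  -- with `h′ < h`, and the descent never ends.
  descend : ∀ k h → Acc ℕ._<_ h → ¬ x k ≃ fromℚ (val h)
  descend k h (acc rec) xk≃val =
    let k′ , xk′<xk = limit<⇒term< {x} {A} x→A {x k} (A<x k)
    in [ (λ (h′ , xk′≃val) →
           descend k′ h′ (rec (val-cancel-< (<-resp-≃ {x k′} {x k} xk′≃val xk≃val xk′<xk))) xk′≃val)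
       , (λ xk′≃½ → ℚ.<-asym (val<½ h) (<-resp-≃ {x k′} {x k} xk′≃½ xk≃val xk′<xk))
       ]′ (𝓢₂-values {x k′} (x∈𝓢 k′))

  not-val : ∀ k → ¬ (∃[ h ] x k ≃ fromℚ (val h))
  not-val k (h , xk≃val) = descend k h (<-wellFounded h) xk≃val

  -- A term equal to `½` has a strictly smaller term, which must be some `val h` and so starts the
  -- descent.
  not-½ : ∀ k → ¬ x k ≃ fromℚ ½
  not-½ k xk≃½ =
    let k′ , xk′<xk = limit<⇒term< {x} {A} x→A {x k} (A<x k)
    in [ not-val k′
       , (λ xk′≃½ → ℚ.<-irrefl {½} refl (<-resp-≃ {x k′} {x k} {½} {½} xk′≃½ xk≃½ xk′<xk))
       ]′ (𝓢₂-values {x k′} (x∈𝓢 k′))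

theorem9p3 : (LowerAccumulationPoint 2 ≐ 𝓢 1) ×
    (𝓢 1 ≐ (_≃ fromℚ ½)) ×
    (∀ A → ¬ UpperAccumulationPoint 2 A)
theorem9p3 =
  ((λ {A} lower → ½⇒𝓢₁ {A} (lower⇒½ {A} lower)) , (λ {A} A∈𝓢₁ → ½⇒lower {A} (𝓢₁⇒½ {A} A∈𝓢₁))) ,
  ((λ {A} → 𝓢₁⇒½ {A}) , (λ {A} → ½⇒𝓢₁ {A})) ,
  no-upper
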